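{- Let $\delta\in(0,\frac12)$. There is a Las Vegas algorithm that, given a graph with $n$ vertices and at least $n^{3/2+\delta}$ edges, returns a 4-cycle of the graph and runs in expected $O(n^{5/4-\delta/2})$ time.
   Context: Graphs are undirected and unweighted, with vertex set $[n]$. The algorithm accesses the graph through two unit-cost oracles: a neighbor oracle, which on query $(v,i)\in[n]\times[n]$ returns the $i$-th neighbor of $v$, or $\bot$ if $i>\deg(v)$; and a degree oracle, which on query $v$ returns $\deg(v)$. Uniformly random vertices can be sampled in unit time. A 4-cycle is a cycle of length 4. A Las Vegas algorithm is a randomized algorithm whose output is always correct and whose running time is bounded in expectation. -}

module Defs where

open import Data.Bool.Base using (if_then_else_)
open import Data.Fin.Base as Fin using (Fin; toℕ; fromℕ<)
import Data.Fin.Properties as Fin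
open import Data.Integer.Base using (+_; -[1+_])
open import Data.List.Base as List using (List; []; _∷_; length; drop)
open import Data.List.Membership.Propositional using (_∈_)
open import Data.List.Relation.Unary.Unique.Propositional using (Unique)
open import Data.Maybe.Base using (Maybe; just; nothing; maybe′; _>>=_)
open import Data.Nat.Base as ℕ using (ℕ; zero; suc; NonZero; _^_)
open import Data.Nat.DivMod using (_%_)
open import Data.Nat.Logarithm using (⌊log₂_⌋)
import Data.Nat.Properties as ℕ
open import Data.Product.Base using (∃; ∃-syntax; _×_; _,_)
open import Data.Rational.Unnormalised.Base as ℚ using (ℚᵘ; mkℚᵘ; ½; _/_; _≃_)
import Data.Rational.Unnormalised.Properties as ℚ
open import Data.Sum.Base as Sum using (_⊎_; inj₁; inj₂)
open import Data.Vec.Base as Vec using (Vec; []; _∷_; lookup; replicate; _[_]≔_)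
open import Function.Bundles using (_⇔_)
open import Level using (0ℓ)
open import Relation.Binary.Core using (Rel)
open import Relation.Binary.Definitions using (Decidable; Symmetric; Irreflexive)
open import Relation.Binary.PropositionalEquality.Core using (_≡_)
open import Relation.Nullary.Decidable.Core using (does; yes; no; _×-dec_)
open import Relation.Nullary.Negation.Core using (¬_)

open import Algebra.Properties.CommutativeMonoid.Sum ℕ.+-0-commutativeMonoid using (sum-syntax)

-- Dedekind cuts: `Lower x q` means q < x and `Upper x q` means x < q.
record ℝ : Set₁ where
  field
    Lower Upper : ℚᵘ → Set
    inhabitedˡ  : ∃ Lower
    inhabitedᵘ  : ∃ Upper
    closedˡ     : ∀ {q r} → q ℚ.< r → Lower r → Lower q
    closedᵘ     : ∀ {q r} → q ℚ.< r → Upper q → Upper r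
    openˡ       : ∀ {q} → Lower q → ∃[ r ] (q ℚ.< r × Lower r)
    openᵘ       : ∀ {r} → Upper r → ∃[ q ] (q ℚ.< r × Upper q)
    disjoint    : ∀ {q} → ¬ (Lower q × Upper q)
    located     : ∀ {q r} → q ℚ.< r → Lower q ⊎ Upper r

  -- Unnormalised rationals carry the equality _≃_, which cuts respect.
  respˡ : ∀ {q r} → q ≃ r → Lower q → Lower r
  respˡ q≃r q∈L with openˡ q∈L
  ... | s , q<s , s∈L = closedˡ (ℚ.<-respˡ-≃ q≃r q<s) s∈L

  respᵘ : ∀ {q r} → q ≃ r → Upper q → Upper r
  respᵘ q≃r q∈U with openᵘ q∈U
  ... | s , s<q , s∈U = closedᵘ (ℚ.<-respʳ-≃ q≃r s<q) s∈U

open ℝ public using (Lower; Upper)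

_<ℝ_ : ℚᵘ → ℝ → Set
q <ℝ x = Lower x q

_ℝ<_ : ℝ → ℚᵘ → Set
x ℝ< q = Upper x q

-- The image of a real under an increasing bijection g of the rationals
-- with inverse f.
private
  transport : (f g : ℚᵘ → ℚᵘ) →
              (∀ {q r} → q ℚ.< r → f q ℚ.< f r) →
              (∀ {q r} → q ℚ.< r → g q ℚ.< g r) →
              (∀ q → f (g q) ≃ q) → (∀ q → g (f q) ≃ q) → ℝ → ℝ
  transport f g f-mono g-mono fg gf x = record
    { Lower      = λ q → x.Lower (f q)
    ; Upper      = λ q → x.Upper (f q)
    ; inhabitedˡ = let q , q∈L = x.inhabitedˡ in g q , x.respˡ (ℚ.≃-sym (fg q)) q∈L
    ; inhabitedᵘ = let q , q∈U = x.inhabitedᵘ in g q , x.respᵘ (ℚ.≃-sym (fg q)) q∈U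
    ; closedˡ    = λ q<r → x.closedˡ (f-mono q<r)
    ; closedᵘ    = λ q<r → x.closedᵘ (f-mono q<r)
    ; openˡ      = λ {q} fq∈L → let r , fq<r , r∈L = x.openˡ fq∈L in
                     g r , ℚ.<-respˡ-≃ (gf q) (g-mono fq<r) , x.respˡ (ℚ.≃-sym (fg r)) r∈L
    ; openᵘ      = λ {r} fr∈U → let q , q<fr , q∈U = x.openᵘ fr∈U in
                     g q , ℚ.<-respʳ-≃ (gf r) (g-mono q<fr) , x.respᵘ (ℚ.≃-sym (fg q)) q∈U
    ; disjoint   = x.disjoint
    ; located    = λ q<r → x.located (f-mono q<r)
    }
    where module x = ℝ x

  cancel : ∀ q a b → a ℚ.+ b ≃ ℚ.0ℚᵘ → (q ℚ.+ a) ℚ.+ b ≃ q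
  cancel q a b a+b≃0 = ℚ.≃-trans (ℚ.+-assoc q a b)
    (ℚ.≃-trans (ℚ.+-congʳ q a+b≃0) (ℚ.+-identityʳ q))

  rescale : ∀ a b q → a ℚ.* b ≃ ℚ.1ℚᵘ → a ℚ.* (b ℚ.* q) ≃ q
  rescale a b q ab≃1 = ℚ.≃-trans (ℚ.≃-sym (ℚ.*-assoc a b q))
    (ℚ.≃-trans (ℚ.*-congʳ ab≃1) (ℚ.*-identityˡ q))

infixl 6 _+ℝ_ _-ℝ_
infix  8 ½*_ -ℝ_

_+ℝ_ : ℚᵘ → ℝ → ℝ
a +ℝ x = transport (ℚ._- a) (ℚ._+ a) (ℚ.+-monoˡ-< (ℚ.- a)) (ℚ.+-monoˡ-< a)
  (λ q → cancel q a (ℚ.- a) (ℚ.+-inverseʳ a))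
  (λ q → cancel q (ℚ.- a) a (ℚ.+-inverseˡ a)) x

½*_ : ℝ → ℝ
½* x = transport (2ℚᵘ ℚ.*_) (½ ℚ.*_) (ℚ.*-monoʳ-<-pos 2ℚᵘ) (ℚ.*-monoʳ-<-pos ½)
  (λ q → rescale 2ℚᵘ ½ q (ℚ.*≡* _≡_.refl)) (λ q → rescale ½ 2ℚᵘ q (ℚ.*≡* _≡_.refl)) x
  where
  2ℚᵘ : ℚᵘ
  2ℚᵘ = + 2 / 1

-ℝ_ : ℝ → ℝ
-ℝ x = record
  { Lower      = λ q → x.Upper (ℚ.- q)
  ; Upper      = λ q → x.Lower (ℚ.- q)
  ; inhabitedˡ = let q , q∈U = x.inhabitedᵘ in ℚ.- q , x.respᵘ (ℚ.≃-sym (ℚ.neg-involutive q)) q∈U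
  ; inhabitedᵘ = let q , q∈L = x.inhabitedˡ in ℚ.- q , x.respˡ (ℚ.≃-sym (ℚ.neg-involutive q)) q∈L
  ; closedˡ    = λ q<r → x.closedᵘ (ℚ.neg-mono-< q<r)
  ; closedᵘ    = λ q<r → x.closedˡ (ℚ.neg-mono-< q<r)
  ; openˡ      = λ {q} -q∈U → let r , r<-q , r∈U = x.openᵘ -q∈U in
                   ℚ.- r , ℚ.<-respˡ-≃ (ℚ.neg-involutive q) (ℚ.neg-mono-< r<-q)
                         , x.respᵘ (ℚ.≃-sym (ℚ.neg-involutive r)) r∈U
  ; openᵘ      = λ {r} -r∈L → let q , -r<q , q∈L = x.openˡ -r∈L in
                   ℚ.- q , ℚ.<-respʳ-≃ (ℚ.neg-involutive r) (ℚ.neg-mono-< -r<q)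
                         , x.respˡ (ℚ.≃-sym (ℚ.neg-involutive q)) q∈L
  ; disjoint   = λ (q∈U , q∈L) → x.disjoint (q∈L , q∈U)
  ; located    = λ q<r → Sum.swap (x.located (ℚ.neg-mono-< q<r))
  }
  where module x = ℝ x

_-ℝ_ : ℚᵘ → ℝ → ℝ
a -ℝ x = a +ℝ (-ℝ x)

-- n ^ r ≤ m and a ≤ b · n ^ r for a rational r, after raising both sides
-- to the power of the denominator of r and clearing negative powers of n.
_^ℚ_≤_ : ℕ → ℚᵘ → ℕ → Set
n ^ℚ mkℚᵘ (+ p)    d-1 ≤ m = n ^ p ℕ.≤ m ^ suc d-1
n ^ℚ mkℚᵘ -[1+ p ] d-1 ≤ m = 1 ℕ.≤ m ^ suc d-1 ℕ.* n ^ suc p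

_≤_·_^ℚ_ : ℕ → ℕ → ℕ → ℚᵘ → Set
a ≤ b · n ^ℚ mkℚᵘ (+ p)    d-1 = a ^ suc d-1 ℕ.≤ b ^ suc d-1 ℕ.* n ^ p
a ≤ b · n ^ℚ mkℚᵘ -[1+ p ] d-1 = a ^ suc d-1 ℕ.* n ^ suc p ℕ.≤ b ^ suc d-1

-- For n ≥ 1 and α real, n ^ α is both the supremum of n ^ r over rational
-- r < α and the infimum of n ^ r over rational r > α.
_^ℝ_≤_ : ℕ → ℝ → ℕ → Set
n ^ℝ α ≤ m = ∀ r → r <ℝ α → n ^ℚ r ≤ m

_≤_·_^ℝ_ : ℕ → ℕ → ℕ → ℝ → Set
a ≤ b · n ^ℝ α = ∀ r → α ℝ< r → a ≤ b · n ^ℚ r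

record Graph (n : ℕ) : Set₁ where
  field
    Adj    : Rel (Fin n) 0ℓ
    adj?   : Decidable Adj
    symm   : Symmetric Adj
    irrefl : Irreflexive _≡_ Adj

  edges : ℕ
  edges = ∑[ u < n ] ∑[ v < n ] (if does (u Fin.<? v ×-dec adj? u v) then 1 else 0)

  FourCycle : Fin n → Fin n → Fin n → Fin n → Set
  FourCycle a b c d =
    Unique (a ∷ b ∷ c ∷ d ∷ []) × Adj a b × Adj b c × Adj c d × Adj d a

open Graph public using (edges; FourCycle)

-- The data behind the oracles: the neighbours of every vertex, each once,
-- in an arbitrary order.
record AdjacencyLists {n} (G : Graph n) : Set where
  field
    neighbours : Fin n → List (Fin n)
    unique     : ∀ v → Unique (neighbours v)
    complete   : ∀ v u → (u ∈ neighbours v) ⇔ Graph.Adj G v u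

  deg : Fin n → ℕ
  deg v = length (neighbours v)

  -- Positions count from 1.
  neighbour : Fin n → ℕ → Maybe (Fin n)
  neighbour v zero    = nothing
  neighbour v (suc i) = List.head (drop i (neighbours v))

-- Randomised word-RAM programs with graph oracles, in which every
-- instruction has unit cost. Vertices are named 1, …, n, and 0 stands for
-- the oracle answer ⊥.

code : ∀ {n} → Maybe (Fin n) → ℕ
code nothing  = 0
code (just v) = suc (toℕ v)

decode : ∀ {n} → ℕ → Maybe (Fin n)
decode zero = nothing
decode {n} (suc w) with w ℕ.<? n
... | yes w<n = just (fromℕ< w<n)
... | no  _   = nothing

data Op : Set where
  add sub mul : Op

-- Instructions for R registers and k output words. The first register of
-- an instruction that writes a register is its target.
data Instr (R k : ℕ) : Set where
  const     : Fin R → ℕ → Instr R k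
  arith     : Op → Fin R → Fin R → Fin R → Instr R k
  load      : Fin R → Fin R → Instr R k            -- target, address
  store     : Fin R → Fin R → Instr R k            -- address, value
  jump      : ℕ → Instr R k
  jumpIf<   : Fin R → Fin R → ℕ → Instr R k
  order     : Fin R → Instr R k                    -- number of vertices
  degree    : Fin R → Fin R → Instr R k            -- target, vertex
  neighbour : Fin R → Fin R → Fin R → Instr R k    -- target, vertex, position
  sample    : Fin R → Instr R k                    -- uniformly random vertex
  return    : Vec (Fin R) k → Instr R k

-- Words consist of wordFactor times as many bits as the number n has, so
-- a single program with O(log n)-bit words serves all inputs.
record Algorithm (k : ℕ) : Set where
  field
    wordFactor : ℕ
    registers  : ℕ
    program    : List (Instr registers k)

data Config (R k : ℕ) : Set where
  running : (pc : ℕ) (regs : Vec ℕ R) (mem : ℕ → ℕ) → Config R k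
  halted  : Vec ℕ k → Config R k

module Execution {k} (A : Algorithm k) {n} {G : Graph n} (I : AdjacencyLists G) where
  open Algorithm A
  private module I = AdjacencyLists I

  wordModulus : ℕ
  wordModulus = 2 ^ (wordFactor ℕ.* suc ⌊log₂ n ⌋)

  toWord : ℕ → ℕ
  toWord x = _%_ x wordModulus {{ℕ.m^n≢0 2 (wordFactor ℕ.* suc ⌊log₂ n ⌋)}}

  evalOp : Op → ℕ → ℕ → ℕ
  evalOp add = ℕ._+_
  evalOp sub = ℕ._∸_
  evalOp mul = ℕ._*_

  initial : Config registers k
  initial = running 0 (replicate registers 0) (λ _ → 0)

  -- The last argument is the vertex drawn if the instruction is `sample`.
  exec : Instr registers k → ℕ → Vec ℕ registers → (ℕ → ℕ) → Fin n → Config registers k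
  exec instr pc regs mem r = go instr
    where
    get : Fin registers → ℕ
    get = lookup regs

    set : Fin registers → ℕ → Config registers k
    set d x = running (suc pc) (regs [ d ]≔ toWord x) mem

    go : Instr registers k → Config registers k
    go (const d x)       = set d x
    go (arith op d a b)  = set d (evalOp op (get a) (get b))
    go (load d a)        = set d (mem (get a))
    go (store a s)       = running (suc pc) regs
                             (λ x → if does (x ℕ.≟ get a) then get s else mem x)
    go (jump l)          = running l regs mem
    go (jumpIf< a b l)   = running (if does (get a ℕ.<? get b) then l else suc pc) regs mem
    go (order d)         = set d n
    go (degree d v)      = set d (maybe′ I.deg 0 (decode (get v)))
    go (neighbour d v i) = set d (code (decode (get v) >>= λ u → I.neighbour u (get i)))
    go (sample d)        = set d (code (just r))
    go (return out)      = halted (Vec.map get out)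

  -- A program counter outside the program never halts.
  step : Config registers k → Fin n → Config registers k
  step (halted out) r = halted out
  step (running pc regs mem) r with List.head (drop pc program)
  ... | just instr = exec instr pc regs mem r
  ... | nothing    = running pc regs mem

  -- A tape of N independent uniform vertices drives N steps; step i sees
  -- only the i-th entry, and uses it only to sample.
  run : ∀ {N} → Config registers k → Vec (Fin n) N → Config registers k
  run c []      = c
  run c (r ∷ ω) = run (step c r) ω

  -- min(T, N), for the number T of steps before halting
  steps : ∀ {N} → Config registers k → Vec (Fin n) N → ℕ
  steps (halted _)             ω       = 0
  steps (running pc regs mem)  []      = 0
  steps c@(running pc regs mem) (r ∷ ω) = suc (steps (step c r) ω)

  sumTapes : ∀ N → (Vec (Fin n) N → ℕ) → ℕ
  sumTapes zero    f = f []
  sumTapes (suc N) f = ∑[ r < n ] sumTapes N (λ ω → f (r ∷ ω))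

  AlwaysCorrect : (Vec ℕ k → Set) → Set
  AlwaysCorrect Spec = ∀ {N} (ω : Vec (Fin n) N) out → run initial ω ≡ halted out → Spec out

  -- E[T] ≤ C · n ^ α. By monotone convergence E[T] is the supremum over N
  -- of E[min(T, N)], the average of min(T, N) over the n ^ N tapes; in
  -- particular a finite bound makes the program halt almost surely.
  ExpectedTimeBound : ℕ → ℝ → Set
  ExpectedTimeBound C α =
    ∀ N → sumTapes N (steps initial) ≤ (C ℕ.* n ^ N) · n ^ℝ α

open Execution public using (AlwaysCorrect; ExpectedTimeBound)

IsFourCycleOutput : ∀ {n} → Graph n → Vec ℕ 4 → Set
IsFourCycleOutput {n} G out = ∃[ a ] ∃[ b ] ∃[ c ] ∃[ d ]
  (FourCycle G a b c d × out ≡ Vec.map (λ v → code (just v)) (a ∷ b ∷ c ∷ d ∷ []))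

{-# OPTIONS --safe #-}
-- Sample a vertex v and walk along the paths v - w - x with x ≠ v, recording
-- the first w through which each x is reached. The second path that reaches
-- the same x closes a 4-cycle, so a round takes O(n) steps, and it succeeds
-- whenever there are at least n such paths; call such vertices v good.
--
-- Suppose that k vertices are good, and let m be the number of edges. Bad
-- vertices are the start of fewer than n² paths altogether, so by
-- Cauchy-Schwarz they meet at most 6/5 m adjacent pairs (v, w) with v bad, and
-- at most about n √k of these have w good. As m ≥ n^(3/2), this leaves
-- m = O(k²). The O(n / k) rounds expected hence take
-- O(n² / √m) = O(n^(5/4 - δ/2)) steps.
module Submission where

open import Defs
open import Data.Bool.Base using (if_then_else_)
open import Data.Fin.Base as Fin using (Fin; zero; suc; toℕ)
open import Data.Fin.Patterns
import Data.Fin.Properties as Fin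
import Data.Integer.Base as ℤ
import Data.Integer.Properties as ℤ
import Data.Integer.Tactic.RingSolver as ℤ-Solver
open import Data.List.Base as List using (List; []; _∷_; length; drop; take; _++_)
open import Data.List.Membership.Propositional using (_∈_; _∉_)
open import Data.List.Membership.Propositional.Properties using (∈-∃++; ∈-++⁺ʳ; ∈-lookup)
open import Data.List.Properties using (length-++; ++-identityʳ; take++drop≡id)
open import Data.List.Relation.Unary.All as All using ([]; _∷_)
open import Data.List.Relation.Unary.AllPairs using ([]; _∷_)
open import Data.List.Relation.Unary.Any using (here; there)
open import Data.List.Relation.Unary.Unique.Propositional using (Unique)
open import Data.List.Relation.Unary.Unique.Propositional.Properties using (drop⁺; Unique[x∷xs]⇒x∉xs)
open import Data.Maybe.Base using (just; maybe′; _>>=_)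
open import Data.Nat.Base using (ℕ; zero; suc; pred; _+_; _*_; _∸_; _^_; _≤_; _<_; z≤n; s≤s; NonZero; >-nonZero; >-nonZero⁻¹)
open import Data.Nat.DivMod using (m<n⇒m%n≡m)
open import Data.Nat.ListAction using () renaming (sum to sumᴸ)
open import Data.Nat.Logarithm using (⌊log₂_⌋; ⌊log₂⌋-mono-≤; ⌊log₂[2^n]⌋≡n)
open import Data.Nat.Properties
open import Data.Nat.Tactic.RingSolver using (solve-∀)
open import Data.Product.Base using (Σ-syntax; ∃-syntax; _×_; _,_; proj₁; proj₂)
open import Data.Rational.Unnormalised.Base as ℚ using (mkℚᵘ; 0ℚᵘ; ½; _/_; _≃_; *≡*)
open import Data.Sum.Base as Sum using (_⊎_; inj₁; inj₂; reduce)
open import Data.Vec.Base as Vec using (Vec; []; _∷_; lookup; _[_]≔_)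
open import Data.Vec.Functional using (Vector)
open import Function.Base using (_∘_)
open import Function.Bundles using (module Equivalence)
open import Relation.Binary.Definitions using (Tri; tri<; tri≈; tri>)
open import Relation.Binary.PropositionalEquality using (_≡_; _≢_; refl; sym; trans; cong; cong₂; subst; subst₂; module ≡-Reasoning)
open import Relation.Nullary.Decidable using (Dec; yes; no; does; _×-dec_; dec-true; dec-false)
open import Relation.Nullary.Negation.Core using (¬_; contradiction)

open import Algebra.Properties.Semiring.Sum +-*-semiring
  using (sum; sum-syntax; sum-cong-≗; ∑-distrib-+; ∑-comm; *-distribˡ-sum; *-distribʳ-sum)

-- A good start never leads to another round: besides v there are only n - 1 vertices, so among n
-- paths two share their end. Density constant 1 suffices because a bad vertex starts at most n - 1
-- paths: at most about n^(3/2) ≤ m of the 2m ordered adjacent pairs begin at a bad vertex, so a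
-- fixed fraction begins at a good one. Two obstacles shape the rest. The program may run forever,
-- so expectations appear only as sums over tapes of finite length, and the argument over rounds
-- becomes an induction on that length. Moreover n / k is a quotient and the exponents are real:
-- expected times are kept multiplied by the number of good vertices, and roots are avoided by
-- comparing powers, so that the estimates stay in the natural numbers.

-- Arithmetic relating the number of edges to the number of good vertices

2ab≤a²+b² : ∀ a b → 2 * (a * b) ≤ a * a + b * b
2ab≤a²+b² a b with ≤-total a b
... | inj₁ a≤b with m≤n⇒∃[o]m+o≡n a≤b
...   | c , refl = subst (2 * (a * (a + c)) ≤_) (square a c) (m≤m+n _ (c * c))
  where
  square : ∀ a c → 2 * (a * (a + c)) + c * c ≡ a * a + (a + c) * (a + c)
  square = solve-∀
2ab≤a²+b² a b | inj₂ b≤a with m≤n⇒∃[o]m+o≡n b≤a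
...   | c , refl = subst (2 * ((b + c) * b) ≤_) (square b c) (m≤m+n _ (c * c))
  where
  square : ∀ b c → 2 * ((b + c) * b) + c * c ≡ (b + c) * (b + c) + b * b
  square = solve-∀

-- Roughly Y² ≤ n³ ≤ M², and the slack 6/5 absorbs the term n * Y: if 6M < 5Y, then 36M² ≤ 25Y²
-- leaves 11Y² + 36n² ≤ 36nY, while 36nY ≤ 9Y² + 36n², which forces Y = 0.
5Y≤6M : ∀ {n M Y} → n ^ 3 ≤ M * M → Y * Y + n * n ≤ n ^ 3 + n * Y → 5 * Y ≤ 6 * M
5Y≤6M {n} {M} {Y} n³≤M² Y²≤ with 5 * Y ≤? 6 * M
... | yes le = le
... | no ¬le = contradiction (subst (λ z → 6 * M < 5 * z) Y≡0 6M<5Y) n≮0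
  where
  6M<5Y : 6 * M < 5 * Y
  6M<5Y = ≰⇒> ¬le

  s₁ : 36 * (Y * Y + n * n) + (36 * n ^ 3 + 6 * M * (6 * M))
       ≤ 36 * (n ^ 3 + n * Y) + (36 * (M * M) + 5 * Y * (5 * Y))
  s₁ = +-mono-≤ (*-monoʳ-≤ 36 Y²≤)
         (+-mono-≤ (*-monoʳ-≤ 36 n³≤M²) (*-mono-≤ (<⇒≤ 6M<5Y) (<⇒≤ 6M<5Y)))

  e₁ : ∀ n M Y n³ → 36 * (Y * Y + n * n) + (36 * n³ + 6 * M * (6 * M))
       ≡ 11 * (Y * Y) + 36 * (n * n) + (25 * (Y * Y) + 36 * n³ + 36 * (M * M))
  e₁ = solve-∀

  e₂ : ∀ n M Y n³ → 36 * (n³ + n * Y) + (36 * (M * M) + 5 * Y * (5 * Y))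
       ≡ 2 * (3 * Y * (6 * n)) + (25 * (Y * Y) + 36 * n³ + 36 * (M * M))
  e₂ = solve-∀

  s₂ : 11 * (Y * Y) + 36 * (n * n) ≤ 2 * (3 * Y * (6 * n))
  s₂ = +-cancelʳ-≤ (25 * (Y * Y) + 36 * n ^ 3 + 36 * (M * M)) _ _
         (subst₂ _≤_ (e₁ n M Y (n ^ 3)) (e₂ n M Y (n ^ 3)) s₁)

  e₃ : ∀ Y n → 11 * (Y * Y) + 36 * (n * n) ≡ 2 * (Y * Y) + (9 * (Y * Y) + 36 * (n * n))
  e₃ = solve-∀

  e₄ : ∀ Y n → 3 * Y * (3 * Y) + 6 * n * (6 * n) ≡ 9 * (Y * Y) + 36 * (n * n)
  e₄ = solve-∀

  s₃ : 2 * (Y * Y) ≤ 0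
  s₃ = +-cancelʳ-≤ (9 * (Y * Y) + 36 * (n * n)) _ _
         (≤-trans (≤-reflexive (sym (e₃ Y n)))
           (≤-trans s₂ (≤-trans (2ab≤a²+b² (3 * Y) (6 * n)) (≤-reflexive (e₄ Y n)))))

  Y≡0 : Y ≡ 0
  Y≡0 = reduce (m*n≡0⇒m≡0∨n≡0 Y (n≤0⇒n≡0 (≤-trans (m≤m+n (Y * Y) _) s₃)))

-- From k² < y follows 2k ≤ k² + 1 ≤ y, so k * y is at most half of y² and can be absorbed on the
-- left.
2M²≤25kn² : ∀ {n M k y} → k * k < y → 2 * M ≤ 5 * y → y * y ≤ k * (n * n + y) →
            2 * (M * M) ≤ 25 * (k * (n * n))
2M²≤25kn² {n} {M} {k} {y} k²<y 2M≤5y y²≤ = *-cancelˡ-≤ 2 (begin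
  2 * (2 * (M * M))           ≡⟨ e₁ M ⟩
  2 * M * (2 * M)             ≤⟨ *-mono-≤ 2M≤5y 2M≤5y ⟩
  5 * y * (5 * y)             ≡⟨ e₂ y ⟩
  25 * (y * y)                ≤⟨ *-monoʳ-≤ 25 y²≤2kn² ⟩
  25 * (2 * (k * (n * n)))    ≡⟨ e₃ (k * (n * n)) ⟩
  2 * (25 * (k * (n * n)))    ∎)
  where
  open ≤-Reasoning
  e₁ : ∀ M → 2 * (2 * (M * M)) ≡ 2 * M * (2 * M)
  e₁ = solve-∀
  e₂ : ∀ y → 5 * y * (5 * y) ≡ 25 * (y * y)
  e₂ = solve-∀
  e₃ : ∀ y → 25 * (2 * y) ≡ 2 * (25 * y)
  e₃ = solve-∀
  e₄ : ∀ k → 2 * k ≡ 2 * (k * 1)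
  e₄ = solve-∀
  e₅ : ∀ k n y → 2 * (k * (n * n + y)) ≡ 2 * (k * (n * n)) + 2 * k * y
  e₅ = solve-∀

  2k≤y : 2 * k ≤ y
  2k≤y = begin
    2 * k       ≡⟨ e₄ k ⟩
    2 * (k * 1) ≤⟨ 2ab≤a²+b² k 1 ⟩
    k * k + 1   ≡⟨ +-comm (k * k) 1 ⟩
    suc (k * k) ≤⟨ k²<y ⟩
    y           ∎

  y²≤2kn² : y * y ≤ 2 * (k * (n * n))
  y²≤2kn² = +-cancelʳ-≤ (y * y) _ _ (begin
    y * y + y * y                 ≡⟨ cong (λ z → y * y + z) (sym (+-identityʳ (y * y))) ⟩
    2 * (y * y)                   ≤⟨ *-monoʳ-≤ 2 y²≤ ⟩
    2 * (k * (n * n + y))         ≡⟨ e₅ k n y ⟩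
    2 * (k * (n * n)) + 2 * k * y ≤⟨ +-monoʳ-≤ (2 * (k * (n * n))) (*-monoˡ-≤ y 2k≤y) ⟩
    2 * (k * (n * n)) + y * y     ∎)

square-cancel-≤ : ∀ {a b} → a * a ≤ b * b → a ≤ b
square-cancel-≤ {a} {b} a²≤b² with a ≤? b
... | yes a≤b = a≤b
... | no a≰b = contradiction (*-mono-< (≰⇒> a≰b) (≰⇒> a≰b)) (≤⇒≯ a²≤b²)

n⁴≤M³ : ∀ {n M} → n ^ 3 ≤ M * M → n ^ 4 ≤ M * M * M
n⁴≤M³ {zero}      _     = z≤n
n⁴≤M³ {n@(suc _)} {M} n³≤M² = square-cancel-≤ (begin
  n ^ 4 * n ^ 4               ≡⟨ ^-distribˡ-+-* n 4 4 ⟨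
  n ^ 8                       ≤⟨ ^-monoʳ-≤ n (n≤1+n 8) ⟩
  n ^ 9                       ≡⟨ ^-*-assoc n 3 3 ⟨
  (n ^ 3) ^ 3                 ≤⟨ ^-monoˡ-≤ 3 n³≤M² ⟩
  (M * M) ^ 3                 ≡⟨ cube M ⟩
  M * M * M * (M * M * M)     ∎)
  where
  open ≤-Reasoning
  cube : ∀ M → M * M * (M * M * (M * M * 1)) ≡ M * M * M * (M * M * M)
  cube = solve-∀

-- Square the second inequality and cancel M³, which dominates n⁴ because n⁸ ≤ n⁹ ≤ M⁶.
4M≤625k² : ∀ {n M k} → .{{NonZero M}} → n ^ 3 ≤ M * M → 2 * (M * M) ≤ 25 * (k * (n * n)) →
           4 * M ≤ 625 * (k * k)
4M≤625k² {n} {M} {k} n³≤M² 2M²≤ = *-cancelʳ-≤ _ _ (M * M * M) {{m*n≢0 (M * M) M {{m*n≢0 M M}}}} (begin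
  4 * M * (M * M * M)                       ≡⟨ e₁ M ⟩
  2 * (M * M) * (2 * (M * M))               ≤⟨ *-mono-≤ 2M²≤ 2M²≤ ⟩
  25 * (k * (n * n)) * (25 * (k * (n * n))) ≡⟨ e₂ k n ⟩
  625 * (k * k) * n ^ 4                     ≤⟨ *-monoʳ-≤ (625 * (k * k)) (n⁴≤M³ {n} {M} n³≤M²) ⟩
  625 * (k * k) * (M * M * M)               ∎)
  where
  open ≤-Reasoning
  e₁ : ∀ M → 4 * M * (M * M * M) ≡ 2 * (M * M) * (2 * (M * M))
  e₁ = solve-∀
  e₂ : ∀ k n → 25 * (k * (n * n)) * (25 * (k * (n * n))) ≡ 625 * (k * k) * (n * (n * (n * (n * 1))))
  e₂ = solve-∀

n³≤M²⇒M≢0 : ∀ {n M} .{{_ : NonZero n}} → n ^ 3 ≤ M * M → NonZero M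
n³≤M²⇒M≢0 {n} {M} n³≤M² = m*n≢0⇒m≢0 M {{>-nonZero (≤-trans (m^n>0 n 3) n³≤M²)}}

-- M is the number of edges and k that of good vertices; Y counts the adjacent
-- pairs (v , w) with v bad, and y those in which moreover w is good.
edge-bound : ∀ {n M k Y y} → .{{NonZero M}} → n ^ 3 ≤ M * M →
             Y * Y + n * n ≤ n ^ 3 + n * Y → y * y ≤ k * (n * n + y) →
             2 * M ≤ Y + y + k * k → 4 * M ≤ 625 * (k * k)
-- Taking 5Y ≤ 6M off 5 · 2M leaves 4M ≤ 5y + 5k², so the larger of y and k² controls M. The
-- constant 625 comes from the case y > k².
edge-bound {n} {M} {k} {Y} {y} n³≤M² Y²≤ y²≤ 2M≤ with y ≤? k * k
... | yes y≤k² = ≤-trans 4M≤5y+5k² (begin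
        5 * y + 5 * (k * k)       ≤⟨ +-monoˡ-≤ (5 * (k * k)) (*-monoʳ-≤ 5 y≤k²) ⟩
        5 * (k * k) + 5 * (k * k) ≡⟨ e (k * k) ⟩
        10 * (k * k)              ≤⟨ *-monoˡ-≤ (k * k) (m≤m+n 10 615) ⟩
        625 * (k * k)             ∎)
  where
  open ≤-Reasoning
  e : ∀ z → 5 * z + 5 * z ≡ 10 * z
  e = solve-∀
  e₁ : ∀ M → 4 * M + 6 * M ≡ 5 * (2 * M)
  e₁ = solve-∀
  e₂ : ∀ Y y K → 5 * (Y + y + K) ≡ 5 * y + 5 * K + 5 * Y
  e₂ = solve-∀
  4M≤5y+5k² : 4 * M ≤ 5 * y + 5 * (k * k)
  4M≤5y+5k² = +-cancelʳ-≤ (6 * M) _ _ (begin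
    4 * M + 6 * M                       ≡⟨ e₁ M ⟩
    5 * (2 * M)                         ≤⟨ *-monoʳ-≤ 5 2M≤ ⟩
    5 * (Y + y + k * k)                 ≡⟨ e₂ Y y (k * k) ⟩
    5 * y + 5 * (k * k) + 5 * Y         ≤⟨ +-monoʳ-≤ (5 * y + 5 * (k * k)) (5Y≤6M {n} {M} {Y} n³≤M² Y²≤) ⟩
    5 * y + 5 * (k * k) + 6 * M         ∎)
... | no y≰k² = 4M≤625k² {n} {M} {k} n³≤M² (2M²≤25kn² {n} {M} {k} {y} (≰⇒> y≰k²) 2M≤5y y²≤)
  where
  open ≤-Reasoning
  e₁ : ∀ M → 2 * (2 * M) + 6 * M ≡ 5 * (2 * M)
  e₁ = solve-∀
  e₂ : ∀ Y y → 5 * (Y + y + y) ≡ 2 * (5 * y) + 5 * Y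
  e₂ = solve-∀
  2M≤5y : 2 * M ≤ 5 * y
  2M≤5y = *-cancelˡ-≤ 2 (+-cancelʳ-≤ (6 * M) _ _ (begin
    2 * (2 * M) + 6 * M    ≡⟨ e₁ M ⟩
    5 * (2 * M)            ≤⟨ *-monoʳ-≤ 5 2M≤ ⟩
    5 * (Y + y + k * k)    ≤⟨ *-monoʳ-≤ 5 (+-monoʳ-≤ (Y + y) (<⇒≤ (≰⇒> y≰k²))) ⟩
    5 * (Y + y + y)        ≡⟨ e₂ Y y ⟩
    2 * (5 * y) + 5 * Y    ≤⟨ +-monoʳ-≤ (2 * (5 * y)) (5Y≤6M {n} {M} {Y} n³≤M² Y²≤) ⟩
    2 * (5 * y) + 6 * M    ∎))

-- Finite sums, the Cauchy-Schwarz inequality and multiplicities in lists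

∑-mono : ∀ {n} {f g : Vector ℕ n} → (∀ i → f i ≤ g i) → sum f ≤ sum g
∑-mono {zero}  f≤g = z≤n
∑-mono {suc n} f≤g = +-mono-≤ (f≤g zero) (∑-mono (f≤g ∘ suc))

∑-const : ∀ n c → ∑[ i < n ] c ≡ n * c
∑-const zero    c = refl
∑-const (suc n) c = cong (c +_) (∑-const n c)

-- Twice the square on the left is a double sum in which the pair (i , j) contributes g i · g j · 2
-- · a i · a j, at most g i · g j · (a i² + a j²), so nothing is subtracted. The weights will be the
-- constant 1 or the indicator of the good vertices.
cauchy-schwarz : ∀ {n} (g a : Vector ℕ n) →
                 ∑[ i < n ] (g i * a i) * ∑[ i < n ] (g i * a i) ≤
                 sum g * ∑[ i < n ] (g i * (a i * a i))
cauchy-schwarz {n} g a = *-cancelˡ-≤ 2 (begin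
  2 * (S * S)                                              ≡⟨ cong (2 *_) (product _ _) ⟩
  2 * ∑[ i < n ] ∑[ j < n ] (g i * a i * (g j * a j))      ≡⟨ double _ ⟩
  ∑[ i < n ] ∑[ j < n ] (2 * (g i * a i * (g j * a j)))
    ≤⟨ ∑-mono (λ i → ∑-mono (λ j → term (g i) (a i) (g j) (a j))) ⟩
  ∑[ i < n ] ∑[ j < n ] (g i * (a i * a i) * g j + g i * (g j * (a j * a j)))
    ≡⟨ sum-cong-≗ {n} (λ i → ∑-distrib-+ {n} (λ j → g i * (a i * a i) * g j) (λ j → g i * (g j * (a j * a j)))) ⟩
  ∑[ i < n ] (∑[ j < n ] (g i * (a i * a i) * g j) + ∑[ j < n ] (g i * (g j * (a j * a j))))
    ≡⟨ ∑-distrib-+ {n} _ _ ⟩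
  ∑[ i < n ] ∑[ j < n ] (g i * (a i * a i) * g j) + ∑[ i < n ] ∑[ j < n ] (g i * (g j * (a j * a j)))
    ≡⟨ cong₂ _+_ (product _ _) (product _ _) ⟨
  Q * sum g + sum g * Q                                    ≡⟨ swap Q (sum g) ⟩
  2 * (sum g * Q)                                          ∎)
  where
  open ≤-Reasoning
  S = ∑[ i < n ] (g i * a i)
  Q = ∑[ i < n ] (g i * (a i * a i))

  product : ∀ (f h : Vector ℕ n) → sum f * sum h ≡ ∑[ i < n ] ∑[ j < n ] (f i * h j)
  product f h = trans (*-distribʳ-sum (sum h) f) (sum-cong-≗ {n} (λ i → *-distribˡ-sum (f i) h))

  double : ∀ (f : Fin n → Fin n → ℕ) → 2 * ∑[ i < n ] ∑[ j < n ] f i j ≡ ∑[ i < n ] ∑[ j < n ] (2 * f i j)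
  double f = trans (*-distribˡ-sum 2 (λ i → sum (f i))) (sum-cong-≗ {n} (λ i → *-distribˡ-sum 2 (f i)))

  swap : ∀ x y → x * y + y * x ≡ 2 * (y * x)
  swap = solve-∀

  factor₁ : ∀ g a h b → 2 * (g * a * (h * b)) ≡ g * h * (2 * (a * b))
  factor₁ = solve-∀

  factor₂ : ∀ g a h b → g * h * (a * a + b * b) ≡ g * (a * a) * h + g * (h * (b * b))
  factor₂ = solve-∀

  term : ∀ g a h b → 2 * (g * a * (h * b)) ≤ g * (a * a) * h + g * (h * (b * b))
  term g a h b = begin
    2 * (g * a * (h * b))               ≡⟨ factor₁ g a h b ⟩
    g * h * (2 * (a * b))               ≤⟨ *-monoʳ-≤ (g * h) (2ab≤a²+b² a b) ⟩
    g * h * (a * a + b * b)             ≡⟨ factor₂ g a h b ⟩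
    g * (a * a) * h + g * (h * (b * b)) ∎

indicator : ∀ {A : Set} → Dec A → ℕ
indicator a? = if does a? then 1 else 0

indicator-yes : ∀ {A : Set} (a? : Dec A) → A → indicator a? ≡ 1
indicator-yes (yes _) _ = refl
indicator-yes (no ¬a) a = contradiction a ¬a

indicator-no : ∀ {A : Set} (a? : Dec A) → ¬ A → indicator a? ≡ 0
indicator-no (yes a) ¬a = contradiction a ¬a
indicator-no (no _)  _  = refl

coindicator : ∀ {A : Set} → Dec A → ℕ
coindicator a? = if does a? then 0 else 1

coindicator+indicator : ∀ {A : Set} (a? : Dec A) → coindicator a? + indicator a? ≡ 1
coindicator+indicator (yes _) = refl
coindicator+indicator (no _)  = refl

coindicator-no : ∀ {A : Set} (a? : Dec A) → ¬ A → coindicator a? ≡ 1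
coindicator-no (yes a) ¬a = contradiction a ¬a
coindicator-no (no _)  _  = refl

indicator*≤ : ∀ {A : Set} (a? : Dec A) x → indicator a? * x ≤ x
indicator*≤ (yes _) x = ≤-reflexive (+-identityʳ x)
indicator*≤ (no _)  x = z≤n

∑-indicator : ∀ {n} (x : Fin n) (f : Vector ℕ n) → ∑[ u < n ] (indicator (x Fin.≟ u) * f u) ≡ f x
∑-indicator {suc n} zero f = begin
  f zero + 0 + ∑[ u < n ] 0 ≡⟨ cong₂ _+_ (+-identityʳ (f zero)) (trans (∑-const n 0) (*-zeroʳ n)) ⟩
  f zero + 0                ≡⟨ +-identityʳ (f zero) ⟩
  f zero                    ∎
  where open ≡-Reasoning
∑-indicator {suc n} (suc x) f = ∑-indicator x (f ∘ suc)

occurrences : ∀ {n} → List (Fin n) → Fin n → ℕ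
occurrences []       u = 0
occurrences (x ∷ xs) u = indicator (x Fin.≟ u) + occurrences xs u

-- Turns sums along adjacency lists into weighted sums over all vertices, where the order of
-- summation can be exchanged.
sum-map-occurrences : ∀ {n} (xs : List (Fin n)) (f : Vector ℕ n) →
                      sumᴸ (List.map f xs) ≡ ∑[ u < n ] (occurrences xs u * f u)
sum-map-occurrences {n} []       f = sym (trans (∑-const n 0) (*-zeroʳ n))
sum-map-occurrences {n} (x ∷ xs) f = begin
  f x + sumᴸ (List.map f xs)
    ≡⟨ cong₂ _+_ (sym (∑-indicator x f)) (sum-map-occurrences xs f) ⟩
  ∑[ u < n ] (indicator (x Fin.≟ u) * f u) + ∑[ u < n ] (occurrences xs u * f u)
    ≡⟨ ∑-distrib-+ {n} _ _ ⟨
  ∑[ u < n ] (indicator (x Fin.≟ u) * f u + occurrences xs u * f u)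
    ≡⟨ sum-cong-≗ {n} (λ u → *-distribʳ-+ (f u) (indicator (x Fin.≟ u)) _) ⟨
  ∑[ u < n ] (occurrences (x ∷ xs) u * f u) ∎
  where open ≡-Reasoning

length-occurrences : ∀ {n} (xs : List (Fin n)) → length xs ≡ ∑[ u < n ] occurrences xs u
length-occurrences {n} xs = begin
  length xs                             ≡⟨ ones xs ⟩
  sumᴸ (List.map (λ _ → 1) xs)      ≡⟨ sum-map-occurrences xs _ ⟩
  ∑[ u < n ] (occurrences xs u * 1)     ≡⟨ sum-cong-≗ {n} (λ u → *-identityʳ _) ⟩
  ∑[ u < n ] occurrences xs u           ∎
  where
  open ≡-Reasoning
  ones : ∀ {A : Set} (xs : List A) → length xs ≡ sumᴸ (List.map (λ _ → 1) xs)
  ones []       = refl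
  ones (x ∷ xs) = cong suc (ones xs)

occurrences-∉ : ∀ {n} {xs : List (Fin n)} {u} → u ∉ xs → occurrences xs u ≡ 0
occurrences-∉ {xs = []}     u∉xs = refl
occurrences-∉ {xs = x ∷ xs} u∉xs =
  cong₂ _+_ (indicator-no (x Fin.≟ _) (u∉xs ∘ here ∘ sym)) (occurrences-∉ (u∉xs ∘ there))

occurrences-∈ : ∀ {n} {xs : List (Fin n)} {u} → Unique xs → u ∈ xs → occurrences xs u ≡ 1
occurrences-∈ {u = u} (x∉xs ∷ _) (here refl) =
  cong₂ _+_ (indicator-yes (u Fin.≟ u) refl) (occurrences-∉ (λ u∈xs → All.lookup x∉xs u∈xs refl))
occurrences-∈ (x∉xs ∷ xs!) (there u∈xs) =
  cong₂ _+_ (indicator-no (_ Fin.≟ _) (All.lookup x∉xs u∈xs)) (occurrences-∈ xs! u∈xs)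

-- Counting two-step paths from bad vertices

module Counting {n} .{{_ : NonZero n}} {G : Graph n} (I : AdjacencyLists G) where
  open AdjacencyLists I
  open Graph G using (Adj; adj?; symm; irrefl)

  -- The number of paths v - w - x with x ≠ v: each neighbour w of v has v among its own neighbours,
  -- whence the 1.
  codegree : Fin n → ℕ
  codegree v = sumᴸ (List.map (λ w → deg w ∸ 1) (neighbours v))

  Good : Fin n → Set
  Good v = n ≤ codegree v

  good? : ∀ v → Dec (Good v)
  good? v = n ≤? codegree v

  good bad : Fin n → ℕ
  good v = indicator (good? v)
  bad  v = coindicator (good? v)

  goodCount : ℕ
  goodCount = ∑[ v < n ] good v

  bad+good≡1 : ∀ v → bad v + good v ≡ 1
  bad+good≡1 v = coindicator+indicator (good? v)

  A : Fin n → Fin n → ℕ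
  A v = occurrences (neighbours v)

  A-yes : ∀ {v u} → Adj v u → A v u ≡ 1
  A-yes vu = occurrences-∈ (unique _) (Equivalence.from (complete _ _) vu)

  A-no : ∀ {v u} → ¬ Adj v u → A v u ≡ 0
  A-no ¬vu = occurrences-∉ (¬vu ∘ Equivalence.to (complete _ _))

  A-sym : ∀ v u → A v u ≡ A u v
  A-sym v u with adj? v u
  ... | yes vu = trans (A-yes vu) (sym (A-yes (symm vu)))
  ... | no ¬vu = trans (A-no ¬vu) (sym (A-no (¬vu ∘ symm)))

  A≤1 : ∀ v u → A v u ≤ 1
  A≤1 v u with adj? v u
  ... | yes vu = ≤-reflexive (A-yes vu)
  ... | no ¬vu = ≤-trans (≤-reflexive (A-no ¬vu)) z≤n

  oriented : Fin n → Fin n → ℕ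
  oriented u v = indicator (u Fin.<? v ×-dec adj? u v)

  oriented+oriented≤A : ∀ u v → oriented u v + oriented v u ≤ A u v
  oriented+oriented≤A u v = helper (adj? u v)
    where
    helper : Dec (Adj u v) → oriented u v + oriented v u ≤ A u v
    helper (no ¬uv) = ≤-trans (≤-reflexive (cong₂ _+_
      (indicator-no (u Fin.<? v ×-dec adj? u v) (λ (_ , uv) → ¬uv uv))
      (indicator-no (v Fin.<? u ×-dec adj? v u) (λ (_ , vu) → ¬uv (symm vu))))) z≤n
    helper (yes uv) with Fin.<-cmp u v
    ... | tri< u<v _ v≮u = ≤-reflexive (trans (cong₂ _+_
      (indicator-yes (u Fin.<? v ×-dec adj? u v) (u<v , uv))
      (indicator-no (v Fin.<? u ×-dec adj? v u) (λ (v<u , _) → v≮u v<u))) (sym (A-yes uv)))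
    ... | tri≈ _ refl _ = contradiction uv (irrefl refl)
    ... | tri> u≮v _ v<u = ≤-reflexive (trans (cong₂ _+_
      (indicator-no (u Fin.<? v ×-dec adj? u v) (λ (u<v , _) → u≮v u<v))
      (indicator-yes (v Fin.<? u ×-dec adj? v u) (v<u , symm uv))) (sym (A-yes uv)))

  2edges≤∑∑A : 2 * edges G ≤ ∑[ u < n ] ∑[ v < n ] A u v
  2edges≤∑∑A = begin
    2 * edges G
      ≡⟨ cong (edges G +_) (trans (+-identityʳ _) (∑-comm {n} {n} oriented)) ⟩
    ∑[ u < n ] ∑[ v < n ] oriented u v + ∑[ u < n ] ∑[ v < n ] oriented v u
      ≡⟨ ∑-distrib-+ {n} _ _ ⟨
    ∑[ u < n ] (∑[ v < n ] oriented u v + ∑[ v < n ] oriented v u)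
      ≡⟨ sum-cong-≗ {n} (λ u → ∑-distrib-+ {n} (oriented u) _) ⟨
    ∑[ u < n ] ∑[ v < n ] (oriented u v + oriented v u)
      ≤⟨ ∑-mono (λ u → ∑-mono (λ v → oriented+oriented≤A u v)) ⟩
    ∑[ u < n ] ∑[ v < n ] A u v ∎
    where open ≤-Reasoning

  badDegree : Fin n → ℕ
  badDegree w = ∑[ v < n ] (bad v * A v w)

  Y y : ℕ
  Y = ∑[ w < n ] badDegree w
  y = ∑[ w < n ] (good w * badDegree w)

  deg≡ : ∀ w → deg w ≡ badDegree w + ∑[ v < n ] (good v * A v w)
  deg≡ w = begin
    deg w                                      ≡⟨ length-occurrences (neighbours w) ⟩
    ∑[ v < n ] A w v                           ≡⟨ sum-cong-≗ {n} split ⟩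
    ∑[ v < n ] (bad v * A v w + good v * A v w) ≡⟨ ∑-distrib-+ {n} _ _ ⟩
    badDegree w + ∑[ v < n ] (good v * A v w)  ∎
    where
    open ≡-Reasoning
    split : ∀ v → A w v ≡ bad v * A v w + good v * A v w
    split v = begin
      A w v                           ≡⟨ A-sym w v ⟩
      A v w                           ≡⟨ *-identityˡ _ ⟨
      1 * A v w                       ≡⟨ cong (_* A v w) (bad+good≡1 v) ⟨
      (bad v + good v) * A v w        ≡⟨ *-distribʳ-+ (A v w) (bad v) (good v) ⟩
      bad v * A v w + good v * A v w  ∎

  -- One factor is enlarged to `deg w`, then split so that `deg w ∸ 1` appears, the factor with
  -- which `codegree` counts paths that do not return to their start.
  badDegree²≤ : ∀ w → badDegree w * badDegree w ≤ badDegree w * (deg w ∸ 1) + badDegree w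
  badDegree²≤ w = begin
    a * a                  ≤⟨ *-monoʳ-≤ a (≤-trans (m≤m+n a _) (≤-reflexive (sym (deg≡ w)))) ⟩
    a * deg w              ≤⟨ *-monoʳ-≤ a (m≤n+m∸n (deg w) 1) ⟩
    a * (1 + (deg w ∸ 1))  ≡⟨ *-suc a (deg w ∸ 1) ⟩
    a + a * (deg w ∸ 1)    ≡⟨ +-comm a _ ⟩
    a * (deg w ∸ 1) + a    ∎
    where
    open ≤-Reasoning
    a = badDegree w

  -- The pairs (v , w) with v bad number Y. A good vertex has, besides the bad neighbours that y
  -- counts, at most `goodCount` good ones.
  ∑∑A≤ : ∑[ u < n ] ∑[ v < n ] A u v ≤ Y + y + goodCount * goodCount
  ∑∑A≤ = begin
    ∑[ u < n ] ∑[ v < n ] A u v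
      ≡⟨ sum-cong-≗ {n} (λ u → length-occurrences (neighbours u)) ⟨
    ∑[ w < n ] deg w
      ≡⟨ sum-cong-≗ {n} deg≡ ⟩
    ∑[ w < n ] (badDegree w + ∑[ v < n ] (good v * A v w))
      ≡⟨ ∑-distrib-+ {n} badDegree _ ⟩
    Y + ∑[ w < n ] ∑[ v < n ] (good v * A v w)
      ≡⟨ cong (Y +_) (∑-comm {n} {n} (λ w v → good v * A v w)) ⟩
    Y + ∑[ v < n ] ∑[ w < n ] (good v * A v w)
      ≡⟨ cong (Y +_) (sum-cong-≗ {n} (λ v → sym (*-distribˡ-sum {n} (good v) (A v)))) ⟩
    Y + ∑[ v < n ] (good v * ∑[ w < n ] A v w)
      ≡⟨ cong (Y +_) (sum-cong-≗ {n} (λ v → cong (good v *_) (sym (length-occurrences (neighbours v))))) ⟩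
    Y + ∑[ v < n ] (good v * deg v)
      ≤⟨ +-monoʳ-≤ Y (∑-mono (λ v → *-monoʳ-≤ (good v) (deg≤ v))) ⟩
    Y + ∑[ v < n ] (good v * (badDegree v + goodCount))
      ≡⟨ cong (Y +_) (sum-cong-≗ {n} (λ v → *-distribˡ-+ (good v) (badDegree v) goodCount)) ⟩
    Y + ∑[ v < n ] (good v * badDegree v + good v * goodCount)
      ≡⟨ cong (Y +_) (∑-distrib-+ {n} _ _) ⟩
    Y + (y + ∑[ v < n ] (good v * goodCount))
      ≡⟨ cong (λ z → Y + (y + z)) (sym (*-distribʳ-sum {n} goodCount good)) ⟩
    Y + (y + goodCount * goodCount)
      ≡⟨ +-assoc Y y _ ⟨
    Y + y + goodCount * goodCount ∎
    where
    open ≤-Reasoning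
    deg≤ : ∀ v → deg v ≤ badDegree v + goodCount
    deg≤ v = begin
      deg v                                      ≡⟨ deg≡ v ⟩
      badDegree v + ∑[ u < n ] (good u * A u v)
        ≤⟨ +-monoʳ-≤ (badDegree v) (∑-mono (λ u → *-monoʳ-≤ (good u) (A≤1 u v))) ⟩
      badDegree v + ∑[ u < n ] (good u * 1)
        ≡⟨ cong (badDegree v +_) (sum-cong-≗ {n} (λ u → *-identityʳ (good u))) ⟩
      badDegree v + goodCount ∎

  -- Double counting: after exchanging the sums, the left sum runs over the paths v - w - x with v
  -- bad and x ≠ v. A bad vertex starts at most n - 1 of them, and the summand `n` records the 1
  -- gained per vertex.
  ∑badDegree*deg : ∑[ w < n ] (badDegree w * (deg w ∸ 1)) + n ≤ n * n
  ∑badDegree*deg = begin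
    ∑[ w < n ] (badDegree w * (deg w ∸ 1)) + n
      ≡⟨ cong (_+ n) (sum-cong-≗ {n} (λ w → *-distribʳ-sum {n} (deg w ∸ 1) (λ v → bad v * A v w))) ⟩
    ∑[ w < n ] ∑[ v < n ] (bad v * A v w * (deg w ∸ 1)) + n
      ≡⟨ cong (_+ n) (∑-comm {n} {n} (λ w v → bad v * A v w * (deg w ∸ 1))) ⟩
    ∑[ v < n ] ∑[ w < n ] (bad v * A v w * (deg w ∸ 1)) + n
      ≡⟨ cong (_+ n) (sum-cong-≗ {n} (λ v → sum-cong-≗ {n} (λ w → *-assoc (bad v) (A v w) (deg w ∸ 1)))) ⟩
    ∑[ v < n ] ∑[ w < n ] (bad v * (A v w * (deg w ∸ 1))) + n
      ≡⟨ cong (_+ n) (sum-cong-≗ {n} (λ v → sym (*-distribˡ-sum {n} (bad v) _))) ⟩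
    ∑[ v < n ] (bad v * ∑[ w < n ] (A v w * (deg w ∸ 1))) + n
      ≡⟨ cong₂ _+_ (sum-cong-≗ {n} (λ v → cong (bad v *_) (sym (sum-map-occurrences (neighbours v) _))))
                   (trans (sym (*-identityʳ n)) (sym (∑-const n 1))) ⟩
    ∑[ v < n ] (bad v * codegree v) + ∑[ v < n ] 1
      ≡⟨ ∑-distrib-+ {n} _ _ ⟨
    ∑[ v < n ] (bad v * codegree v + 1)
      ≤⟨ ∑-mono bound ⟩
    ∑[ v < n ] n
      ≡⟨ ∑-const n n ⟩
    n * n ∎
    where
    open ≤-Reasoning
    bound : ∀ v → bad v * codegree v + 1 ≤ n
    bound v = helper (good? v)
      where
      helper : (g? : Dec (Good v)) → coindicator g? * codegree v + 1 ≤ n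
      helper (yes _)   = >-nonZero⁻¹ n
      helper (no n≰cv) = ≤-trans (≤-reflexive (trans (+-comm _ 1) (cong suc (+-identityʳ (codegree v))))) (≰⇒> n≰cv)

  Y²≤ : Y * Y + n * n ≤ n ^ 3 + n * Y
  Y²≤ = begin
    Y * Y + n * n
      ≡⟨ cong (_+ n * n) (cong₂ _*_ one one) ⟩
    ∑[ w < n ] (1 * badDegree w) * ∑[ w < n ] (1 * badDegree w) + n * n
      ≤⟨ +-monoˡ-≤ (n * n) (cauchy-schwarz (λ _ → 1) badDegree) ⟩
    ∑[ w < n ] 1 * ∑[ w < n ] (1 * (badDegree w * badDegree w)) + n * n
      ≡⟨ cong (λ z → z * ∑[ w < n ] (1 * (badDegree w * badDegree w)) + n * n) (trans (∑-const n 1) (*-identityʳ n)) ⟩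
    n * ∑[ w < n ] (1 * (badDegree w * badDegree w)) + n * n
      ≤⟨ +-monoˡ-≤ (n * n) (*-monoʳ-≤ n (∑-mono (λ w → ≤-trans (≤-reflexive (*-identityˡ _)) (badDegree²≤ w)))) ⟩
    n * ∑[ w < n ] (badDegree w * (deg w ∸ 1) + badDegree w) + n * n
      ≡⟨ cong (λ z → n * z + n * n) (∑-distrib-+ {n} _ badDegree) ⟩
    n * (∑[ w < n ] (badDegree w * (deg w ∸ 1)) + Y) + n * n
      ≡⟨ regroup n _ Y ⟩
    n * (∑[ w < n ] (badDegree w * (deg w ∸ 1)) + n) + n * Y
      ≤⟨ +-monoˡ-≤ (n * Y) (*-monoʳ-≤ n ∑badDegree*deg) ⟩
    n * (n * n) + n * Y
      ≡⟨ cong (λ z → n * (n * z) + n * Y) (*-identityʳ n) ⟨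
    n ^ 3 + n * Y ∎
    where
    open ≤-Reasoning
    one : Y ≡ ∑[ w < n ] (1 * badDegree w)
    one = sum-cong-≗ {n} (λ w → sym (*-identityˡ (badDegree w)))
    regroup : ∀ n Q Y → n * (Q + Y) + n * n ≡ n * (Q + n) + n * Y
    regroup = solve-∀

  -- The weight `good w` is dropped from the quadratic part but kept on the linear one, so that y
  -- and not Y reappears on the right, as `2M²≤25kn²` requires.
  y²≤ : y * y ≤ goodCount * (n * n + y)
  y²≤ = begin
    y * y
      ≤⟨ cauchy-schwarz good badDegree ⟩
    goodCount * ∑[ w < n ] (good w * (badDegree w * badDegree w))
      ≤⟨ *-monoʳ-≤ goodCount (∑-mono (λ w → *-monoʳ-≤ (good w) (badDegree²≤ w))) ⟩
    goodCount * ∑[ w < n ] (good w * (badDegree w * (deg w ∸ 1) + badDegree w))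
      ≡⟨ cong (goodCount *_) (sum-cong-≗ {n} (λ w → *-distribˡ-+ (good w) _ (badDegree w))) ⟩
    goodCount * ∑[ w < n ] (good w * (badDegree w * (deg w ∸ 1)) + good w * badDegree w)
      ≡⟨ cong (goodCount *_) (∑-distrib-+ {n} _ _) ⟩
    goodCount * (∑[ w < n ] (good w * (badDegree w * (deg w ∸ 1))) + y)
      ≤⟨ *-monoʳ-≤ goodCount (+-monoˡ-≤ y (∑-mono (λ w → indicator*≤ (good? w) _))) ⟩
    goodCount * (∑[ w < n ] (badDegree w * (deg w ∸ 1)) + y)
      ≤⟨ *-monoʳ-≤ goodCount (+-monoˡ-≤ y (≤-trans (m≤m+n _ n) ∑badDegree*deg)) ⟩
    goodCount * (n * n + y) ∎
    where
    open ≤-Reasoning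

  4edges≤625goodCount² : n ^ 3 ≤ edges G * edges G → 4 * edges G ≤ 625 * (goodCount * goodCount)
  4edges≤625goodCount² n³≤m² = edge-bound {n} {edges G} {goodCount} {Y} {y}
    {{n³≤M²⇒M≢0 {n} n³≤m²}}
    n³≤m² Y²≤ y²≤ (≤-trans 2edges≤∑∑A ∑∑A≤)

-- Word size, and a calculus of expected running times

n<2^[1+⌊log₂n⌋] : ∀ n → n < 2 ^ suc ⌊log₂ n ⌋
n<2^[1+⌊log₂n⌋] n with n <? 2 ^ suc ⌊log₂ n ⌋
... | yes n< = n<
... | no n≮ = contradiction (begin-strict
  ⌊log₂ n ⌋                         <⟨ n<1+n _ ⟩
  suc ⌊log₂ n ⌋                     ≡⟨ ⌊log₂[2^n]⌋≡n (suc ⌊log₂ n ⌋) ⟨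
  ⌊log₂ 2 ^ suc ⌊log₂ n ⌋ ⌋         ≤⟨ ⌊log₂⌋-mono-≤ (≮⇒≥ n≮) ⟩
  ⌊log₂ n ⌋                         ∎) (<-irrefl refl)
  where open ≤-Reasoning

decode-code : ∀ {n} (u : Fin n) → decode {n} (code (just u)) ≡ just u
decode-code {n} u with toℕ u <? n
... | yes u<n = cong just (Fin.fromℕ<-toℕ u u<n)
... | no u≮n  = contradiction (Fin.toℕ<n u) u≮n

module Potential {k} (alg : Algorithm k) {n} {G : Graph n} (I : AdjacencyLists G)
                 (Spec : Vec ℕ k → Set) (g : ℕ) where
  open Algorithm alg
  open Execution alg I
  private module I = AdjacencyLists I

  -- Within N steps from c only outputs satisfying Spec are returned, and
  -- g times the expected number of these steps is at most g * T + E.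
  record Bounded (N : ℕ) (c : Config registers k) (T E : ℕ) : Set where
    field
      sound  : ∀ {M} → M ≤ N → (ω : Vec (Fin n) M) → ∀ {out} → run c ω ≡ halted out → Spec out
      within : ∀ {M} → M ≤ N → g * sumTapes M (steps c) ≤ n ^ M * (g * T + E)

  open Bounded public

  sumTapes-zero : ∀ M → sumTapes M (λ _ → 0) ≡ 0
  sumTapes-zero zero    = refl
  sumTapes-zero (suc M) = trans (sum-cong-≗ {n} (λ _ → sumTapes-zero M)) (trans (∑-const n 0) (*-zeroʳ n))

  sumTapes-suc : ∀ M (f : Vec (Fin n) M → ℕ) → sumTapes M (λ ω → suc (f ω)) ≡ n ^ M + sumTapes M f
  sumTapes-suc zero    f = refl
  sumTapes-suc (suc M) f = begin
    ∑[ r < n ] sumTapes M (λ ω → suc (f (r ∷ ω)))      ≡⟨ sum-cong-≗ {n} (λ r → sumTapes-suc M (f ∘ (r ∷_))) ⟩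
    ∑[ r < n ] (n ^ M + sumTapes M (λ ω → f (r ∷ ω)))  ≡⟨ ∑-distrib-+ {n} _ _ ⟩
    ∑[ r < n ] (n ^ M) + sumTapes (suc M) f            ≡⟨ cong (_+ sumTapes (suc M) f) (∑-const n (n ^ M)) ⟩
    n ^ suc M + sumTapes (suc M) f                     ∎
    where open ≡-Reasoning

  weaken : ∀ {N c T E T′ E′} → g * T + E ≤ g * T′ + E′ → Bounded N c T E → Bounded N c T′ E′
  weaken le b .sound          = b .sound
  weaken le b .within {M} M≤N = ≤-trans (b .within M≤N) (*-monoʳ-≤ (n ^ M) le)

  more-time : ∀ {N c T T′ E} → T ≤ T′ → Bounded N c T E → Bounded N c T′ E
  more-time {E = E} T≤T′ = weaken (+-monoˡ-≤ E (*-monoʳ-≤ g T≤T′))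

  bounded-halted : ∀ {N out T E} → Spec out → Bounded N (halted out) T E
  bounded-halted spec .sound _ ω eq = subst Spec (halted-injective (trans (sym (run-halted ω)) eq)) spec
    where
    run-halted : ∀ {M out} (ω : Vec (Fin n) M) → run (halted out) ω ≡ halted out
    run-halted []      = refl
    run-halted (r ∷ ω) = run-halted ω
    halted-injective : ∀ {o o′ : Vec ℕ k} → _≡_ {A = Config registers k} (halted o) (halted o′) → o ≡ o′
    halted-injective refl = refl
  bounded-halted spec .within {M} _ =
    ≤-trans (≤-reflexive (trans (cong (g *_) (sumTapes-zero M)) (*-zeroʳ g))) z≤n

  bounded-zero : ∀ {pc regs mem T E} → Bounded zero (running pc regs mem) T E
  bounded-zero .sound  z≤n [] ()
  bounded-zero .within z≤n = ≤-trans (≤-reflexive (*-zeroʳ g)) z≤n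

  steps-average : ∀ {M pc regs mem T E′} (E : Vector ℕ n) → ∑[ r < n ] E r ≤ n * E′ →
                  (∀ r → g * sumTapes M (steps (step (running pc regs mem) r)) ≤ n ^ M * (g * T + E r)) →
                  g * sumTapes (suc M) (steps (running pc regs mem)) ≤ n ^ suc M * (g * suc T + E′)
  steps-average {M} {pc} {regs} {mem} {T} {E′} E ∑E≤ bound = begin
    g * ∑[ r < n ] sumTapes M (λ ω → suc (steps (c r) ω))
      ≡⟨ cong (g *_) (sum-cong-≗ {n} (λ r → sumTapes-suc M (steps (c r)))) ⟩
    g * ∑[ r < n ] (n ^ M + sumTapes M (steps (c r)))
      ≡⟨ *-distribˡ-sum {n} g _ ⟩
    ∑[ r < n ] (g * (n ^ M + sumTapes M (steps (c r))))
      ≤⟨ ∑-mono (λ r → ≤-trans (≤-reflexive (*-distribˡ-+ g (n ^ M) _)) (+-monoʳ-≤ (g * n ^ M) (bound r))) ⟩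
    ∑[ r < n ] (g * n ^ M + n ^ M * (g * T + E r))
      ≡⟨ sum-cong-≗ {n} (λ r → collect g (n ^ M) T (E r)) ⟩
    ∑[ r < n ] (n ^ M * (g * suc T) + n ^ M * E r)
      ≡⟨ ∑-distrib-+ {n} _ _ ⟩
    ∑[ r < n ] (n ^ M * (g * suc T)) + ∑[ r < n ] (n ^ M * E r)
      ≡⟨ cong₂ _+_ (∑-const n _) (sym (*-distribˡ-sum {n} (n ^ M) E)) ⟩
    n * (n ^ M * (g * suc T)) + n ^ M * ∑[ r < n ] E r
      ≤⟨ +-monoʳ-≤ (n * (n ^ M * (g * suc T))) (*-monoʳ-≤ (n ^ M) ∑E≤) ⟩
    n * (n ^ M * (g * suc T)) + n ^ M * (n * E′)
      ≡⟨ factor n (n ^ M) (g * suc T) E′ ⟩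
    n ^ suc M * (g * suc T + E′) ∎
    where
    open ≤-Reasoning
    c = step (running pc regs mem)
    collect : ∀ g p T e → g * p + p * (g * T + e) ≡ p * (g * suc T) + p * e
    collect = solve-∀
    factor : ∀ n p x e → n * (p * x) + p * (n * e) ≡ n * p * (x + e)
    factor = solve-∀

  -- T bounds the steps that are paid for whatever is drawn, whereas E may depend on the draw and
  -- only its average counts.
  bounded-random : ∀ {N pc regs mem T E′} (E : Vector ℕ n) → ∑[ r < n ] E r ≤ n * E′ →
                   (∀ r → Bounded N (step (running pc regs mem) r) T (E r)) →
                   Bounded (suc N) (running pc regs mem) (suc T) E′
  bounded-random E ∑E≤ b .sound {zero}  _         []      ()
  bounded-random E ∑E≤ b .sound {suc M} (s≤s M≤N) (r ∷ ω) = b r .sound M≤N ω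
  bounded-random E ∑E≤ b .within {zero}  _         = ≤-trans (≤-reflexive (*-zeroʳ g)) z≤n
  bounded-random {pc = pc} {regs} {mem} E ∑E≤ b .within {suc M} (s≤s M≤N) =
    steps-average {M} {pc} {regs} {mem} E ∑E≤ (λ r → b r .within M≤N)

  -- N stays although a step uses up a tape entry, since `Bounded` covers all shorter tapes. Thus
  -- only sampling lowers N, and an induction on N advances once per round.
  bounded-step : ∀ {N pc regs mem T E} → (∀ r → Bounded N (step (running pc regs mem) r) T E) →
                 Bounded N (running pc regs mem) (suc T) E
  bounded-step b .sound {zero}  _   []      ()
  bounded-step b .sound {suc M} M<N (r ∷ ω) = b r .sound (<⇒≤ M<N) ω
  bounded-step b .within {zero}  _  = ≤-trans (≤-reflexive (*-zeroʳ g)) z≤n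
  bounded-step {pc = pc} {regs} {mem} {E = E} b .within {suc M} M<N =
    steps-average {M} {pc} {regs} {mem} (λ _ → E) (≤-reflexive (∑-const n E)) (λ r → b r .within (<⇒≤ M<N))

  Fetch : ℕ → Instr registers k → Set
  Fetch pc instr = List.head (drop pc program) ≡ just instr

  step-exec : ∀ {pc instr regs mem r} → Fetch pc instr → step (running pc regs mem) r ≡ exec instr pc regs mem r
  step-exec {pc} fetch with List.head (drop pc program) | fetch
  ... | _ | refl = refl

  module Rules (wordFactor>0 : 1 ≤ wordFactor) where

    -- No reduction modulo the word size takes place as long as the values written are at most n;
    -- this is the source of the side conditions `≤ n` in the rules.
    toWord-≤ : ∀ {x} → x ≤ n → toWord x ≡ x
    toWord-≤ {x} x≤n = m<n⇒m%n≡m {{m^n≢0 2 (wordFactor * suc ⌊log₂ n ⌋)}} (begin-strict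
      x                                 ≤⟨ x≤n ⟩
      n                                 <⟨ n<2^[1+⌊log₂n⌋] n ⟩
      2 ^ suc ⌊log₂ n ⌋                 ≤⟨ ^-monoʳ-≤ 2 (m≤n*m _ wordFactor {{>-nonZero wordFactor>0}}) ⟩
      2 ^ (wordFactor * suc ⌊log₂ n ⌋)  ∎)
      where open ≤-Reasoning

    code≤n : (u : Fin n) → code (just u) ≤ n
    code≤n = Fin.toℕ<n

    module _ {N T E pc : ℕ} {regs : Vec ℕ registers} {mem : ℕ → ℕ} where

      bounded-exec : ∀ {instr} → Fetch pc instr →
                     (∀ r → Bounded N (exec instr pc regs mem r) T E) → Bounded N (running pc regs mem) (suc T) E
      bounded-exec fetch b =
        bounded-step (λ r → subst (λ c → Bounded N c T E) (sym (step-exec {pc} fetch)) (b r))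

      private
        set : ∀ {d x y} → x ≡ y → y ≤ n → Bounded N (running (suc pc) (regs [ d ]≔ y) mem) T E →
              Bounded N (running (suc pc) (regs [ d ]≔ toWord x) mem) T E
        set {d} refl y≤n = subst (λ z → Bounded N (running (suc pc) (regs [ d ]≔ z) mem) T E) (sym (toWord-≤ y≤n))

      bounded-const : ∀ {d x} → Fetch pc (const d x) → x ≤ n →
        Bounded N (running (suc pc) (regs [ d ]≔ x) mem) T E → Bounded N (running pc regs mem) (suc T) E
      bounded-const fetch x≤n b = bounded-exec fetch (λ _ → set refl x≤n b)

      bounded-arith : ∀ {op d a b} → Fetch pc (arith op d a b) → evalOp op (lookup regs a) (lookup regs b) ≤ n →
        Bounded N (running (suc pc) (regs [ d ]≔ evalOp op (lookup regs a) (lookup regs b)) mem) T E →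
        Bounded N (running pc regs mem) (suc T) E
      bounded-arith fetch x≤n b = bounded-exec fetch (λ _ → set refl x≤n b)

      bounded-load : ∀ {d a y} → Fetch pc (load d a) → mem (lookup regs a) ≡ y → y ≤ n →
        Bounded N (running (suc pc) (regs [ d ]≔ y) mem) T E → Bounded N (running pc regs mem) (suc T) E
      bounded-load fetch eq y≤n b = bounded-exec fetch (λ _ → set eq y≤n b)

      bounded-store : ∀ {a s} → Fetch pc (store a s) →
        Bounded N (running (suc pc) regs (λ x → if does (x ≟ lookup regs a) then lookup regs s else mem x)) T E →
        Bounded N (running pc regs mem) (suc T) E
      bounded-store fetch b = bounded-exec fetch (λ _ → b)

      bounded-jump : ∀ {l} → Fetch pc (jump l) →
        Bounded N (running l regs mem) T E → Bounded N (running pc regs mem) (suc T) E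
      bounded-jump fetch b = bounded-exec fetch (λ _ → b)

      bounded-jump-taken : ∀ {a b l} → Fetch pc (jumpIf< a b l) → lookup regs a < lookup regs b →
        Bounded N (running l regs mem) T E → Bounded N (running pc regs mem) (suc T) E
      bounded-jump-taken {a} {b} {l} fetch a<b bd = bounded-exec fetch (λ _ →
        subst (λ t → Bounded N (running (if t then l else suc pc) regs mem) T E)
              (sym (dec-true (lookup regs a <? lookup regs b) a<b)) bd)

      bounded-jump-skipped : ∀ {a b l} → Fetch pc (jumpIf< a b l) → ¬ lookup regs a < lookup regs b →
        Bounded N (running (suc pc) regs mem) T E → Bounded N (running pc regs mem) (suc T) E
      bounded-jump-skipped {a} {b} {l} fetch a≮b bd = bounded-exec fetch (λ _ →
        subst (λ t → Bounded N (running (if t then l else suc pc) regs mem) T E)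
              (sym (dec-false (lookup regs a <? lookup regs b) a≮b)) bd)

      bounded-order : ∀ {d} → Fetch pc (order d) →
        Bounded N (running (suc pc) (regs [ d ]≔ n) mem) T E → Bounded N (running pc regs mem) (suc T) E
      bounded-order fetch b = bounded-exec fetch (λ _ → set refl ≤-refl b)

      bounded-degree : ∀ {d a u} → Fetch pc (degree d a) → lookup regs a ≡ code (just u) → I.deg u ≤ n →
        Bounded N (running (suc pc) (regs [ d ]≔ I.deg u) mem) T E → Bounded N (running pc regs mem) (suc T) E
      bounded-degree {u = u} fetch eq d≤n b = bounded-exec fetch (λ _ →
        set (cong (maybe′ I.deg 0) (trans (cong decode eq) (decode-code u))) d≤n b)

      bounded-neighbour : ∀ {d a i u x} → Fetch pc (neighbour d a i) → lookup regs a ≡ code (just u) →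
        I.neighbour u (lookup regs i) ≡ just x →
        Bounded N (running (suc pc) (regs [ d ]≔ code (just x)) mem) T E → Bounded N (running pc regs mem) (suc T) E
      bounded-neighbour {i = i} {u} {x} fetch eq nbr b = bounded-exec fetch (λ _ →
        set (cong code (trans (cong (_>>= λ w → I.neighbour w (lookup regs i)) (trans (cong decode eq) (decode-code u))) nbr))
            (code≤n x) b)

      bounded-return : ∀ {out} → Fetch pc (return out) → Spec (Vec.map (lookup regs) out) →
        Bounded N (running pc regs mem) (suc T) E
      bounded-return fetch spec = bounded-exec fetch (λ _ → bounded-halted spec)

    bounded-sample : ∀ {N T E′ pc regs mem d} (E : Vector ℕ n) → Fetch pc (sample d) → ∑[ r < n ] E r ≤ n * E′ →
      (∀ r → Bounded N (running (suc pc) (regs [ d ]≔ code (just r)) mem) T (E r)) →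
      Bounded (suc N) (running pc regs mem) (suc T) E′
    bounded-sample {N} {T} {pc = pc} {regs} {mem} {d} E fetch ∑E≤ b = bounded-random E ∑E≤ (λ r →
      subst (λ c → Bounded N c T (E r)) (sym (step-exec {pc} fetch))
        (subst (λ z → Bounded N (running (suc pc) (regs [ d ]≔ z) mem) T (E r)) (sym (toWord-≤ (code≤n r))) (b r)))

-- Adjacency lists and the search program

drop-∷ : ∀ {A : Set} {x : A} {xs} j ys → drop j ys ≡ x ∷ xs →
         j < length ys × List.head (drop j ys) ≡ just x × drop (suc j) ys ≡ xs
drop-∷ zero    (y ∷ ys) refl = s≤s z≤n , refl , refl
drop-∷ (suc j) (y ∷ ys) eq   = let j< , hd , tl = drop-∷ j ys eq in s≤s j< , hd , tl

drop-[] : ∀ {A : Set} j (ys : List A) → drop j ys ≡ [] → length ys ≤ j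
drop-[] zero    []       eq = z≤n
drop-[] (suc j) []       eq = z≤n
drop-[] (suc j) (y ∷ ys) eq = s≤s (drop-[] j ys eq)

lookup-injective : ∀ {A : Set} {xs : List A} → Unique xs → ∀ {i j} → List.lookup xs i ≡ List.lookup xs j → i ≡ j
lookup-injective (_ ∷ _)     {zero}  {zero}  _  = refl
lookup-injective (x∉xs ∷ _)  {zero}  {suc j} eq = contradiction eq (All.lookup x∉xs (∈-lookup j))
lookup-injective (x∉xs ∷ _)  {suc i} {zero}  eq = contradiction (sym eq) (All.lookup x∉xs (∈-lookup i))
lookup-injective (_ ∷ xs!)   {suc i} {suc j} eq = cong suc (lookup-injective xs! eq)

length-unique : ∀ {n} {xs : List (Fin n)} → Unique xs → length xs ≤ n
length-unique xs! = Fin.injective⇒≤ (lookup-injective xs!)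

unique-split : ∀ {A : Set} (ys : List A) {x zs} → Unique (ys ++ x ∷ zs) → x ∉ ys × x ∉ zs
unique-split []       (x∉zs ∷ _) = (λ ()) , λ x∈zs → All.lookup x∉zs x∈zs refl
unique-split (y ∷ ys) (y∉ ∷ u)   = let x∉ys , x∉zs = unique-split ys u in
  (λ { (here refl)  → All.lookup y∉ (∈-++⁺ʳ ys (here refl)) refl
     ; (there x∈ys) → x∉ys x∈ys }) , x∉zs

-- The registers hold 1, 0, v, deg v, i, w, deg w, j, x and mem x, where w is
-- the i-th neighbour of the sampled vertex v and x the j-th neighbour of w.
-- mem x is the neighbour of v through which x was reached first in this
-- round, and 0 if x has not been reached.
search : Algorithm 4
search = record
  { wordFactor = 1
  ; registers  = 10
  ; program    =
      const 0F 1
    ∷ const 1F 0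
    ∷ sample 2F
    ∷ order 8F
    ∷ store 8F 1F              -- 4: clear the table
    ∷ arith sub 8F 8F 0F
    ∷ jumpIf< 1F 8F 4
    ∷ degree 3F 2F
    ∷ const 4F 0
    ∷ jumpIf< 4F 3F 11         -- 9: next neighbour w of v
    ∷ jump 0
    ∷ arith add 4F 4F 0F       -- 11
    ∷ neighbour 5F 2F 4F
    ∷ degree 6F 5F
    ∷ const 7F 0
    ∷ jumpIf< 7F 6F 17         -- 15: next neighbour x of w
    ∷ jump 9
    ∷ arith add 7F 7F 0F       -- 17
    ∷ neighbour 8F 5F 7F
    ∷ jumpIf< 8F 2F 22
    ∷ jumpIf< 2F 8F 22
    ∷ jump 15
    ∷ load 9F 8F               -- 22: x ≠ v
    ∷ jumpIf< 1F 9F 26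
    ∷ store 8F 5F
    ∷ jump 15
    ∷ return (2F ∷ 9F ∷ 8F ∷ 5F ∷ [])
    ∷ []
  }

regs : (v d i w e j x t : ℕ) → Vec ℕ 10
regs v d i w e j x t = 1 ∷ 0 ∷ v ∷ d ∷ i ∷ w ∷ e ∷ j ∷ x ∷ t ∷ []

update : (ℕ → ℕ) → ℕ → ℕ → ℕ → ℕ
update mem a s x = if does (x ≟ a) then s else mem x

update-same : ∀ mem {a s} x → x ≡ a → update mem a s x ≡ s
update-same mem {a} {s} x eq = cong (if_then s else mem x) (dec-true (x ≟ a) eq)

update-other : ∀ mem {a s} x → x ≢ a → update mem a s x ≡ mem x
update-other mem {a} {s} x ne = cong (if_then s else mem x) (dec-false (x ≟ a) ne)

-- The costs are 1 for `order`, 3 per table entry cleared, 2 for `degree` and `const`, 9 per unit of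
-- fuel, 13 per neighbour of v (5 to enter its list, 6 to pass over v in it, 2 to leave it), and 2
-- to restart.
roundTime : ℕ → ℕ
roundTime n = 1 + (n * 3 + (2 + (n * 9 + (n * 13 + 2))))

shift : ∀ x c y → x + (c + y) ≡ c + (x + y)
shift = solve-∀

-- Analysis of one round

module Search {n} .{{_ : NonZero n}} {G : Graph n} (I : AdjacencyLists G) where
  open AdjacencyLists I renaming (neighbour to nthNeighbour)
  open Graph G using (Adj; symm; irrefl)
  open Counting I
  open Potential search I (IsFourCycleOutput G) goodCount
  open Rules ≤-refl

  ⌜_⌝ : Fin n → ℕ
  ⌜ u ⌝ = code (just u)

  deg≤n : ∀ v → deg v ≤ n
  deg≤n v = length-unique (unique v)

  -- `restart` stands for the rest of the computation and is granted only when v is not good. For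
  -- good v the bounds therefore hold with any `E`, in particular 0.
  module Round (v : Fin n) {N E : ℕ}
               (restart : ¬ Good v → ∀ rs mem → Bounded N (running 0 rs mem) 0 E) where

    retime : ∀ {c T T′} → T ≡ T′ → Bounded N c T E → Bounded N c T′ E
    retime refl b = b

    -- `L` consists of v and the vertices reached in this round. An empty entry certifies that x is
    -- not in `L`, except for v, which is there from the start. A filled entry names a t whose edge
    -- to x is no longer pending; so when the edge from w to x is about to be explored, t ≠ w and a
    -- 4-cycle is closed.
    record Table (mem : ℕ → ℕ) (L : List (Fin n)) (Pending : Fin n → Fin n → Set) : Set where
      field
        distinct : Unique L
        entry    : ∀ x → (mem ⌜ x ⌝ ≡ 0 × (x ∈ L → x ≡ v)) ⊎
                         ∃[ t ] (mem ⌜ x ⌝ ≡ ⌜ t ⌝ × Adj v t × Adj t x × ¬ Pending t x)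

    open Table

    relax : ∀ {mem L P Q} → (∀ {t x} → Q t x → P t x) → Table mem L P → Table mem L Q
    relax Q⇒P tab .distinct = tab .distinct
    relax Q⇒P tab .entry x with tab .entry x
    ... | inj₁ e                         = inj₁ e
    ... | inj₂ (t , eq , vt , tx , ¬Ptx) = inj₂ (t , eq , vt , tx , ¬Ptx ∘ Q⇒P)

    -- One unit exceeds the number of vertices not yet reached, so that
    -- a 4-cycle can be reported when every vertex has been reached.
    fuel : List (Fin n) → ℕ
    fuel L = suc n ∸ length L

    -- Pending w ws xs t x: the edge from t to x is still to be explored in
    -- this round, when xs are the remaining neighbours of w, and ws those of v.
    Pending : Fin n → List (Fin n) → List (Fin n) → Fin n → Fin n → Set
    Pending w ws xs t x = t ∈ ws ⊎ (t ≡ w × x ∈ xs)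

    Inner : (w : Fin n) (i j x t : ℕ) (mem : ℕ → ℕ) (T pc : ℕ) → Set
    Inner w i j x t mem T pc =
      Bounded N (running pc (regs ⌜ v ⌝ (deg v) i ⌜ w ⌝ (deg w) j x t) mem) T E

    module _ {w : Fin n} (vw : Adj v w) {ws : List (Fin n)} (w∉ws : w ∉ ws) {i : ℕ} where

      reach : ∀ {mem L xs x} → mem ⌜ x ⌝ ≡ 0 → x ∉ L → Unique (x ∷ xs) → Adj w x →
              Table mem L (Pending w ws (x ∷ xs)) → Table (update mem ⌜ x ⌝ ⌜ w ⌝) (x ∷ L) (Pending w ws xs)
      reach {mem} {L} {xs} {x} mx≡0 x∉L x∷xs! wx tab .distinct =
        All.tabulate (λ y∈L x≡y → x∉L (subst (_∈ L) (sym x≡y) y∈L)) ∷ tab .distinct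
      reach {mem} {L} {xs} {x} mx≡0 x∉L x∷xs! wx tab .entry y with y Fin.≟ x
      ... | yes refl = inj₂ (w , update-same mem ⌜ y ⌝ refl , vw , wx ,
                             λ { (inj₁ w∈ws) → w∉ws w∈ws ; (inj₂ (_ , y∈xs)) → Unique[x∷xs]⇒x∉xs x∷xs! y∈xs })
      ... | no y≢x with tab .entry y
      ...   | inj₁ (my≡0 , y∈L⇒y≡v) =
                inj₁ (trans same my≡0 , λ { (here y≡x) → contradiction y≡x y≢x ; (there y∈L) → y∈L⇒y≡v y∈L })
              where same = update-other mem ⌜ y ⌝ (y≢x ∘ Fin.toℕ-injective ∘ suc-injective)
      ...   | inj₂ (t , my≡t , vt , ty , ¬P) =
                inj₂ (t , trans same my≡t , vt , ty , ¬P ∘ Sum.map₂ (λ (t≡w , y∈xs) → t≡w , there y∈xs))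
              where same = update-other mem ⌜ y ⌝ (y≢x ∘ Fin.toℕ-injective ∘ suc-injective)

      fourCycle : ∀ {t x} → x ≢ v → Adj v t → Adj t x → t ≢ w → Adj w x → FourCycle G v t x w
      fourCycle x≢v vt tx t≢w wx =
        ( ((λ v≡t → irrefl v≡t vt) ∷ (x≢v ∘ sym) ∷ (λ v≡w → irrefl v≡w vw) ∷ [])
        ∷ ((λ t≡x → irrefl t≡x tx) ∷ t≢w ∷ [])
        ∷ ((λ x≡w → irrefl x≡w (symm wx)) ∷ [])
        ∷ [] ∷ []) , vt , tx , symm wx , symm vw

      -- Either x joins `L`, which is how one unit of fuel gets used up, or x was reached before and
      -- the program returns.
      probe : ∀ {x xs j t mem L T} → x ≢ v → Adj w x → Unique (x ∷ xs) → Table mem L (Pending w ws (x ∷ xs)) →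
              (∀ {mem′ L′ t′} → Table mem′ L′ (Pending w ws xs) → length L′ ≡ suc (length L) →
                 Inner w i j ⌜ x ⌝ t′ mem′ (fuel L′ * 9 + T) 15) →
              Inner w i j ⌜ x ⌝ t mem (4 + ((n ∸ length L) * 9 + T)) 22
      probe {x} x≢v wx x∷xs! tab continue with tab .entry x
      ... | inj₁ (mx≡0 , x∈L⇒x≡v) =
        bounded-load refl mx≡0 z≤n
        (bounded-jump-skipped refl (λ ())
        (bounded-store refl
        (bounded-jump refl
        (continue (reach mx≡0 (x≢v ∘ x∈L⇒x≡v) x∷xs! wx tab) refl))))
      ... | inj₂ (t , mx≡t , vt , tx , ¬P) =
        bounded-load refl mx≡t (code≤n t)
        (bounded-jump-taken refl (s≤s z≤n)
        (bounded-return refl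
          (v , t , x , w , fourCycle x≢v vt tx (λ t≡w → ¬P (inj₂ (t≡w , here refl))) wx , refl)))

      -- The list of w is cut at v, which must not be probed: `scan` treats the run before v and,
      -- with empty `ys`, the run after it. Bounds compose from the end of the program backwards, so
      -- the rest is passed as `continue`.
      scan : ∀ xs {ys j x t mem L T} → drop j (neighbours w) ≡ xs ++ ys → v ∉ xs →
             Table mem L (Pending w ws (xs ++ ys)) →
             (∀ {j′ x′ t′ mem′ L′} → drop j′ (neighbours w) ≡ ys → Table mem′ L′ (Pending w ws ys) →
                length L′ ≡ length xs + length L → Inner w i j′ x′ t′ mem′ (fuel L′ * 9 + T) 15) →
             Inner w i j x t mem (fuel L * 9 + T) 15
      scan []       eq v∉xs tab continue = continue eq tab refl
      scan (x ∷ xs) {ys} {j} {_} {_} {mem} {L} {T} eq v∉xs tab continue =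
        -- As `length L` ≤ n, a unit of fuel can be split off. Its 9 steps are the 3 here, at most 2
        -- comparisons, and 4 in `probe`.
        retime (cong (λ z → z * 9 + T) (sym (+-∸-assoc 1 (length-unique (tab .distinct)))))
        (bounded-jump-taken refl j<
        (bounded-arith refl j+1≤n
        (bounded-neighbour refl refl (subst (λ z → nthNeighbour w z ≡ just x) (+-comm 1 j) hd)
        (compare (Fin.<-cmp x v)))))
        where
        facts = drop-∷ j (neighbours w) eq
        j<    = proj₁ facts
        hd    = proj₁ (proj₂ facts)
        tl    = proj₂ (proj₂ facts)

        j+1≤n : j + 1 ≤ n
        j+1≤n = ≤-trans (≤-reflexive (+-comm j 1)) (≤-trans j< (deg≤n w))

        x∷xs! : Unique (x ∷ xs ++ ys)
        x∷xs! = subst Unique eq (drop⁺ j (unique w))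

        wx : Adj w x
        wx = Equivalence.to (complete w x)
               (subst (x ∈_) (trans (cong (take j (neighbours w) ++_) (sym eq)) (take++drop≡id j (neighbours w)))
                 (∈-++⁺ʳ (take j (neighbours w)) (here refl)))

        x≢v : x ≢ v
        x≢v x≡v = v∉xs (here (sym x≡v))

        probed : ∀ {t} → Inner w i (j + 1) ⌜ x ⌝ t mem (4 + ((n ∸ length L) * 9 + T)) 22
        probed = probe x≢v wx x∷xs! tab (λ tab′ len →
          scan xs (trans (cong (λ z → drop z (neighbours w)) (+-comm j 1)) tl) (v∉xs ∘ there) tab′
            (λ eq″ tab″ len″ → continue eq″ tab″
              (trans len″ (trans (cong (length xs +_) len) (+-suc (length xs) (length L))))))

        compare : ∀ {t} → Tri (x Fin.< v) (x ≡ v) (v Fin.< x) → Inner w i (j + 1) ⌜ x ⌝ t mem (6 + ((n ∸ length L) * 9 + T)) 19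
        compare (tri< x<v _ _)   = more-time (n≤1+n _) (bounded-jump-taken refl (s≤s x<v) probed)
        compare (tri≈ _ x≡v _)   = contradiction x≡v x≢v
        compare (tri> x≮v _ v<x) =
          bounded-jump-skipped refl (x≮v ∘ ≤-pred) (bounded-jump-taken refl (s≤s v<x) probed)

      -- There is no equality test: for x = v both strict comparisons fail, and control falls
      -- through to the jump.
      skip : ∀ {j x t mem zs T} → drop j (neighbours w) ≡ v ∷ zs →
             Inner w i (j + 1) ⌜ v ⌝ t mem T 15 → Inner w i j x t mem (6 + T) 15
      skip {j} eq b =
        bounded-jump-taken refl j<
        (bounded-arith refl (≤-trans (≤-reflexive (+-comm j 1)) (≤-trans j< (deg≤n w)))
        (bounded-neighbour refl refl (subst (λ z → nthNeighbour w z ≡ just v) (+-comm 1 j) hd)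
        (bounded-jump-skipped refl (<-irrefl refl)
        (bounded-jump-skipped refl (<-irrefl refl)
        (bounded-jump refl b)))))
        where
        facts = drop-∷ j (neighbours w) eq
        j<    = proj₁ facts
        hd    = proj₁ (proj₂ facts)

    -- The length invariant holds because every path explored so far has added a vertex to `L`, a
    -- repetition having ended the program. The successor accounts for v, which `L` contains from
    -- the start.
    explore : ∀ ws {i w e j x t mem L} → drop i (neighbours v) ≡ ws → Table mem L (λ t _ → t ∈ ws) →
              length L + sumᴸ (List.map (λ w → deg w ∸ 1) ws) ≡ suc (codegree v) →
              Bounded N (running 9 (regs ⌜ v ⌝ (deg v) i w e j x t) mem) (fuel L * 9 + (length ws * 13 + 2)) E
    explore [] {i} {L = L} eq tab len = retime (sym (shift (fuel L * 9) 2 0))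
      (bounded-jump-skipped refl (≤⇒≯ (drop-[] i (neighbours v) eq))
      (bounded-jump refl
      (more-time z≤n (restart ¬good _ _))))
      where
      ¬good : ¬ Good v
      -- With no neighbour left, `L` has codegree v + 1 distinct entries, so codegree v < n.
      ¬good n≤ = <-irrefl refl (begin-strict
        n             ≤⟨ n≤ ⟩
        codegree v    <⟨ n<1+n _ ⟩
        suc (codegree v)  ≡⟨ len ⟨
        length L + 0  ≡⟨ +-identityʳ _ ⟩
        length L      ≤⟨ length-unique (tab .distinct) ⟩
        n             ∎)
        where open ≤-Reasoning
    explore (w ∷ ws) {i} {L = L} eq tab len = retime (sym (shift (fuel L * 9) 5 _))
      (bounded-jump-taken refl i<
      (bounded-arith refl (≤-trans (≤-reflexive (+-comm i 1)) (≤-trans i< (deg≤n v)))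
      (bounded-neighbour refl refl (subst (λ z → nthNeighbour v z ≡ just w) (+-comm 1 i) hd)
      (bounded-degree refl refl (deg≤n w)
      (bounded-const refl z≤n
      (scan vw w∉ws ys split v∉ys
        (relax (λ { (inj₁ t∈ws) → there t∈ws ; (inj₂ (t≡w , _)) → here t≡w }) tab) afterFirst))))))
      where
      facts = drop-∷ i (neighbours v) eq
      i<    = proj₁ facts
      hd    = proj₁ (proj₂ facts)
      tl    = proj₂ (proj₂ facts)

      w∈ : w ∈ neighbours v
      w∈ = subst (w ∈_) (trans (cong (take i (neighbours v) ++_) (sym eq)) (take++drop≡id i (neighbours v)))
             (∈-++⁺ʳ (take i (neighbours v)) (here refl))

      vw : Adj v w
      vw = Equivalence.to (complete v w) w∈

      w∉ws : w ∉ ws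
      w∉ws = Unique[x∷xs]⇒x∉xs (subst Unique eq (drop⁺ i (unique v)))

      decomposition = ∈-∃++ (Equivalence.from (complete w v) (symm vw))
      ys    = proj₁ decomposition
      zs    = proj₁ (proj₂ decomposition)
      split : neighbours w ≡ ys ++ v ∷ zs
      split = proj₂ (proj₂ decomposition)
      v∉ys  = proj₁ (unique-split ys (subst Unique split (unique w)))
      v∉zs  = proj₂ (unique-split ys (subst Unique split (unique w)))

      later = sumᴸ (List.map (λ w → deg w ∸ 1) ws)

      deg∸1 : deg w ∸ 1 ≡ length ys + length zs
      deg∸1 = cong (_∸ 1) (trans (cong length split) (trans (length-++ ys) (+-suc (length ys) (length zs))))

      regroup : ∀ z y l s → z + (y + l) + s ≡ l + (y + z + s)
      regroup = solve-∀

      afterSecond : ∀ {j x t mem L′ L″} → length L′ ≡ length ys + length L →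
        drop j (neighbours w) ≡ [] → Table mem L″ (Pending w ws []) → length L″ ≡ length zs + length L′ →
        Inner w (i + 1) j x t mem (fuel L″ * 9 + (2 + (length ws * 13 + 2))) 15
      afterSecond {j} {L′ = L′} {L″} len′ eq″ tab″ len″ =
        retime (sym (shift (fuel L″ * 9) 2 _))
        (bounded-jump-skipped refl (≤⇒≯ (drop-[] j (neighbours w) eq″))
        (bounded-jump refl
        (explore ws (trans (cong (λ z → drop z (neighbours v)) (+-comm i 1)) tl) (relax inj₁ tab″) (begin
          length L″ + later                                ≡⟨ cong (_+ later) (trans len″ (cong (length zs +_) len′)) ⟩
          length zs + (length ys + length L) + later       ≡⟨ regroup (length zs) (length ys) (length L) later ⟩
          length L + (length ys + length zs + later)       ≡⟨ cong (λ d → length L + (d + later)) deg∸1 ⟨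
          length L + (deg w ∸ 1 + later)                   ≡⟨ len ⟩
          suc (codegree v)                                 ∎))))
        where open ≡-Reasoning

      afterFirst : ∀ {j x t mem L′} → drop j (neighbours w) ≡ v ∷ zs → Table mem L′ (Pending w ws (v ∷ zs)) →
        length L′ ≡ length ys + length L →
        Inner w (i + 1) j x t mem (fuel L′ * 9 + (8 + (length ws * 13 + 2))) 15
      afterFirst {j} {L′ = L′} eq′ tab′ len′ =
        retime (sym (shift (fuel L′ * 9) 6 _))
        (skip vw w∉ws eq′
        (scan vw w∉ws zs
          (trans (cong (λ z → drop z (neighbours w)) (+-comm j 1))
                 (trans (proj₂ (proj₂ (drop-∷ j (neighbours w) eq′))) (sym (++-identityʳ zs))))
          v∉zs
          (relax (Sum.map₂ (λ (t≡w , x∈) → t≡w , there (subst (_ ∈_) (++-identityʳ zs) x∈))) tab′)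
          (afterSecond {L′ = L′} len′)))

    -- Earlier rounds may have left entries in the table, so all are erased, from address n
    -- downwards. Address `suc a` belongs to vertex number a, since names start at 1.
    clear : ∀ a {d i w e j t mem T} → (∀ u → a < toℕ u → mem ⌜ u ⌝ ≡ 0) → a < n →
            (∀ {mem′} → (∀ u → mem′ ⌜ u ⌝ ≡ 0) → Bounded N (running 7 (regs ⌜ v ⌝ d i w e j 0 t) mem′) T E) →
            Bounded N (running 4 (regs ⌜ v ⌝ d i w e j (suc a) t) mem) (suc a * 3 + T) E
    clear a {d} {i} {w} {e} {j} {t} {mem} {T} above a<n continue =
      bounded-store refl (bounded-arith refl (<⇒≤ a<n) (next a a<n above′ continue))
      where
      mem′ = update mem (suc a) 0

      above′ : ∀ u → a ≤ toℕ u → mem′ ⌜ u ⌝ ≡ 0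
      above′ u a≤u with toℕ u ≟ a
      ... | yes u≡a = update-same mem ⌜ u ⌝ (cong suc u≡a)
      ... | no u≢a  = trans (update-other mem ⌜ u ⌝ (u≢a ∘ suc-injective)) (above u (≤∧≢⇒< a≤u (u≢a ∘ sym)))

      next : ∀ a {mem} → a < n → (∀ u → a ≤ toℕ u → mem ⌜ u ⌝ ≡ 0) →
             (∀ {mem′} → (∀ u → mem′ ⌜ u ⌝ ≡ 0) → Bounded N (running 7 (regs ⌜ v ⌝ d i w e j 0 t) mem′) T E) →
             Bounded N (running 6 (regs ⌜ v ⌝ d i w e j a t) mem) (suc (a * 3 + T)) E
      next zero    a<n above continue = bounded-jump-skipped refl (λ ()) (continue (λ u → above u z≤n))
      next (suc a) a<n above continue = bounded-jump-taken refl (s≤s z≤n) (clear a above (<⇒≤ a<n) continue)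

    visit : ∀ {d i w e j x t mem} →
            Bounded N (running 3 (regs ⌜ v ⌝ d i w e j x t) mem) (roundTime n) E
    visit {d} {i} {w} {e} {j} {x} {t} {mem} =
      bounded-order refl
      (subst (λ z → Bounded N (running 4 (regs ⌜ v ⌝ d i w e j z t) mem) (z * 3 + (2 + (n * 9 + (n * 13 + 2)))) E)
             (suc-pred n)
      (clear (pred n) (λ u <u → contradiction <u (≤⇒≯ (≤-pred (≤-trans (Fin.toℕ<n u) (≤-reflexive (sym (suc-pred n)))))))
             (≤-reflexive (suc-pred n)) (λ cleared →
      bounded-degree refl refl (deg≤n v)
      (bounded-const refl z≤n
      (more-time (+-monoʳ-≤ (n * 9) (+-monoˡ-≤ 2 (*-monoˡ-≤ 13 (deg≤n v))))
      (explore (neighbours v) {L = v ∷ []} refl (start cleared) refl))))))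
      where
      start : ∀ {mem} → (∀ u → mem ⌜ u ⌝ ≡ 0) → Table mem (v ∷ []) (λ t _ → t ∈ neighbours v)
      start cleared .distinct = [] ∷ []
      start cleared .entry x  = inj₁ (cleared x , λ { (here x≡v) → x≡v })

  -- The expected number of rounds

  τ : ℕ
  τ = 3 + roundTime n

  badCount : ℕ
  badCount = ∑[ v < n ] bad v

  badCount+goodCount≡n : badCount + goodCount ≡ n
  badCount+goodCount≡n = begin
    badCount + goodCount            ≡⟨ ∑-distrib-+ {n} bad good ⟨
    ∑[ v < n ] (bad v + good v)     ≡⟨ sum-cong-≗ {n} bad+good≡1 ⟩
    ∑[ v < n ] 1                    ≡⟨ trans (∑-const n 1) (*-identityʳ n) ⟩
    n                               ∎
    where open ≡-Reasoning

  -- A round takes time at most τ and returns with probability goodCount / n.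
  search-bounded : ∀ N rs mem → Bounded N (running 0 rs mem) 0 (n * τ)
  search-bounded zero    rs mem = bounded-zero
  search-bounded (suc N) (_ ∷ _ ∷ _ ∷ _ ∷ _ ∷ _ ∷ _ ∷ _ ∷ _ ∷ _ ∷ []) mem =
    -- Multiplied by `goodCount`, the time τ of the round costs goodCount * τ. The potential n * τ
    -- survives only for bad v, hence averages to badCount * τ, and both together make up n * τ.
    weaken (≤-reflexive potential)
      (bounded-const refl (>-nonZero⁻¹ n)
      (bounded-const refl z≤n
      (bounded-sample (λ v → bad v * (n * τ)) refl (≤-reflexive average)
        (λ v → Round.visit v (restart v)))))
    where
    restart : ∀ v → ¬ Good v → ∀ rs mem → Bounded N (running 0 rs mem) 0 (bad v * (n * τ))
    restart v ¬good rs mem = subst (Bounded N (running 0 rs mem) 0)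
      (sym (trans (cong (_* (n * τ)) (coindicator-no (good? v) ¬good)) (*-identityˡ _)))
      (search-bounded N rs mem)

    average : ∑[ v < n ] (bad v * (n * τ)) ≡ n * (badCount * τ)
    average = trans (sym (*-distribʳ-sum {n} (n * τ) bad)) (exchange badCount n τ)
      where
      exchange : ∀ b n t → b * (n * t) ≡ n * (b * t)
      exchange = solve-∀

    potential : goodCount * τ + badCount * τ ≡ goodCount * 0 + n * τ
    potential = begin
      goodCount * τ + badCount * τ ≡⟨ *-distribʳ-+ τ goodCount badCount ⟨
      (goodCount + badCount) * τ   ≡⟨ cong (_* τ) (trans (+-comm goodCount badCount) badCount+goodCount≡n) ⟩
      n * τ                        ≡⟨ cong (_+ n * τ) (*-zeroʳ goodCount) ⟨
      goodCount * 0 + n * τ        ∎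
      where open ≡-Reasoning

  open Execution search I using (initial; steps; sumTapes)

  search-correct : AlwaysCorrect search I (IsFourCycleOutput G)
  search-correct {N} ω out eq = search-bounded N _ _ .sound ≤-refl ω eq

  search-time : ∀ N → goodCount * sumTapes N (steps initial) ≤ n ^ N * (33 * (n * n))
  search-time N = ≤-trans (search-bounded N _ _ .within ≤-refl) (*-monoʳ-≤ (n ^ N) (begin
    goodCount * 0 + n * τ          ≡⟨ cong (_+ n * τ) (*-zeroʳ goodCount) ⟩
    n * τ                          ≡⟨ expand n ⟩
    -- Here τ = 25n + 8 with 25 = 3 + 9 + 13; n ≥ 1 turns the 8 into 8n, which gives 33.
    n * (25 * n) + n * 8           ≤⟨ +-monoʳ-≤ (n * (25 * n)) (*-monoʳ-≤ n (*-monoʳ-≤ 8 (>-nonZero⁻¹ n))) ⟩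
    n * (25 * n) + n * (8 * n)     ≡⟨ collect n ⟩
    33 * (n * n)                   ∎))
    where
    open ≤-Reasoning
    expand : ∀ n → n * (4 + (n * 3 + (2 + (n * 9 + (n * 13 + 2))))) ≡ n * (25 * n) + n * 8
    expand = solve-∀
    collect : ∀ n → n * (25 * n) + n * (8 * n) ≡ 33 * (n * n)
    collect = solve-∀

-- From the squared time bound to real exponents

open import Data.Integer.Base using (+_; -[1+_])

^-distribʳ-* : ∀ k m n → (m * n) ^ k ≡ m ^ k * n ^ k
^-distribʳ-* zero    m n = refl
^-distribʳ-* (suc k) m n = trans (cong (m * n *_) (^-distribʳ-* k m n)) (interchange m n (m ^ k) (n ^ k))
  where
  interchange : ∀ a b c d → a * b * (c * d) ≡ a * c * (b * d)
  interchange = solve-∀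

-- The density hypothesis is used at the exponent s = 4 - 2 r, where r is the
-- exponent of the time bound: r > 5/4 - δ/2 says that s - 3/2 < δ.
exponent : ∀ P d e → + e ≡ + 4 ℤ.* + suc d ℤ.- + 2 ℤ.* P →
           (+ 2 / 1) ℚ.* (ℚ.- (mkℚᵘ P d ℚ.- (+ 5 / 4))) ≃ mkℚᵘ (+ e) d ℚ.- (+ 3 / 2)
exponent P d e eq = *≡* (begin
  + 2 ℤ.* (ℤ.- (P ℤ.* + 4 ℤ.+ -[1+ 4 ] ℤ.* Q)) ℤ.* + (suc d * 2)
    ≡⟨ cong (+ 2 ℤ.* (ℤ.- (P ℤ.* + 4 ℤ.+ -[1+ 4 ] ℤ.* Q)) ℤ.*_) (ℤ.pos-* (suc d) 2) ⟩
  + 2 ℤ.* (ℤ.- (P ℤ.* + 4 ℤ.+ -[1+ 4 ] ℤ.* Q)) ℤ.* (Q ℤ.* + 2)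
    ≡⟨ ring P Q ⟩
  ((+ 4 ℤ.* Q ℤ.- + 2 ℤ.* P) ℤ.* + 2 ℤ.+ -[1+ 2 ] ℤ.* Q) ℤ.* (+ 1 ℤ.* (Q ℤ.* + 4))
    ≡⟨ cong₂ (λ x y → (x ℤ.* + 2 ℤ.+ -[1+ 2 ] ℤ.* Q) ℤ.* y) (sym eq)
         (trans (cong (+ 1 ℤ.*_) (sym (ℤ.pos-* (suc d) 4))) (sym (ℤ.pos-* 1 (suc d * 4)))) ⟩
  (+ e ℤ.* + 2 ℤ.+ -[1+ 2 ] ℤ.* Q) ℤ.* + (1 * (suc d * 4)) ∎)
  where
  open ≡-Reasoning
  Q = + suc d
  ring : ∀ P Q → + 2 ℤ.* (ℤ.- (P ℤ.* + 4 ℤ.+ -[1+ 4 ] ℤ.* Q)) ℤ.* (Q ℤ.* + 2) ≡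
                 ((+ 4 ℤ.* Q ℤ.- + 2 ℤ.* P) ℤ.* + 2 ℤ.+ -[1+ 2 ] ℤ.* Q) ℤ.* (+ 1 ℤ.* (Q ℤ.* + 4))
  ring = ℤ-Solver.solve-∀

-- Squaring the time bound lets g² be traded for m without a root. The constant is 429 = 13 · 33,
-- where 13 is 25/2, the root of 625/4, rounded up.
combine : ∀ {n m g S p} → 4 * m ≤ 625 * (g * g) → g * S ≤ p * (33 * (n * n)) →
          m * (S * S) ≤ (429 * p) * (429 * p) * n ^ 4
combine {n} {m} {g} {S} {p} 4m≤ gS≤ = *-cancelˡ-≤ 4 (begin
  4 * (m * (S * S))                                      ≡⟨ *-assoc 4 m (S * S) ⟨
  4 * m * (S * S)                                        ≤⟨ *-monoˡ-≤ (S * S) 4m≤ ⟩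
  625 * (g * g) * (S * S)                                ≡⟨ square 625 g S ⟩
  625 * (g * S * (g * S))                                ≤⟨ *-monoʳ-≤ 625 (*-mono-≤ gS≤ gS≤) ⟩
  625 * (p * (33 * (n * n)) * (p * (33 * (n * n))))      ≡⟨ coefficient 625 33 p (n * n) ⟩
  625 * (33 * 33) * (p * p * (n * n * (n * n)))
    ≤⟨ *-monoˡ-≤ (p * p * (n * n * (n * n))) (≤ᵇ⇒≤ (625 * (33 * 33)) (4 * (429 * 429)) _) ⟩
  4 * (429 * 429) * (p * p * (n * n * (n * n)))          ≡⟨ regroup 4 429 p n ⟩
  4 * (429 * p * (429 * p) * n ^ 4)                      ∎)
  where
  open ≤-Reasoning
  square : ∀ a g S → a * (g * g) * (S * S) ≡ a * (g * S * (g * S))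
  square = solve-∀
  coefficient : ∀ a c p q → a * (p * (c * q) * (p * (c * q))) ≡ a * (c * c) * (p * p * (q * q))
  coefficient = solve-∀
  regroup : ∀ a c p n → a * (c * c) * (p * p * (n * n * (n * n))) ≡ a * (c * p * (c * p) * (n * (n * (n * (n * 1)))))
  regroup = solve-∀

module Roots (n m S B : ℕ) .{{_ : NonZero n}} (mS²≤B²n⁴ : m * (S * S) ≤ B * B * n ^ 4) where

  -- The q-th power of the hypothesis, with m ^ q replaced by n ^ e. Cancelling n ^ e and taking a
  -- square root leaves n to the power (4q - e) / 2, which is p in `root⁺` and -p in `root⁻`.
  raise : ∀ q e → n ^ e ≤ m ^ q → S ^ q * S ^ q * n ^ e ≤ B ^ q * B ^ q * n ^ (4 * q)
  raise q e nᵉ≤mᵠ = begin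
    S ^ q * S ^ q * n ^ e        ≤⟨ *-monoʳ-≤ (S ^ q * S ^ q) nᵉ≤mᵠ ⟩
    S ^ q * S ^ q * m ^ q        ≡⟨ *-comm (S ^ q * S ^ q) (m ^ q) ⟩
    m ^ q * (S ^ q * S ^ q)      ≡⟨ cong (m ^ q *_) (^-distribʳ-* q S S) ⟨
    m ^ q * (S * S) ^ q          ≡⟨ ^-distribʳ-* q m (S * S) ⟨
    (m * (S * S)) ^ q            ≤⟨ ^-monoˡ-≤ q mS²≤B²n⁴ ⟩
    (B * B * n ^ 4) ^ q          ≡⟨ ^-distribʳ-* q (B * B) (n ^ 4) ⟩
    (B * B) ^ q * (n ^ 4) ^ q    ≡⟨ cong₂ _*_ (^-distribʳ-* q B B) (^-*-assoc n 4 q) ⟩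
    B ^ q * B ^ q * n ^ (4 * q)  ∎
    where open ≤-Reasoning

  root⁺ : ∀ q p e → e + 2 * p ≡ 4 * q → n ^ e ≤ m ^ q → S ^ q ≤ B ^ q * n ^ p
  root⁺ q p e eq nᵉ≤mᵠ = square-cancel-≤ (*-cancelʳ-≤ _ _ (n ^ e) {{m^n≢0 n e}} (begin
    S ^ q * S ^ q * n ^ e                        ≤⟨ raise q e nᵉ≤mᵠ ⟩
    B ^ q * B ^ q * n ^ (4 * q)                  ≡⟨ cong (λ z → B ^ q * B ^ q * n ^ z) eq ⟨
    B ^ q * B ^ q * n ^ (e + 2 * p)              ≡⟨ cong (B ^ q * B ^ q *_) (^-distribˡ-+-* n e (2 * p)) ⟩
    B ^ q * B ^ q * (n ^ e * n ^ (p + (p + 0)))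
      ≡⟨ cong (λ z → B ^ q * B ^ q * (n ^ e * z)) (trans (cong (λ z → n ^ (p + z)) (+-identityʳ p)) (^-distribˡ-+-* n p p)) ⟩
    B ^ q * B ^ q * (n ^ e * (n ^ p * n ^ p))    ≡⟨ regroup (B ^ q) (n ^ e) (n ^ p) ⟩
    B ^ q * n ^ p * (B ^ q * n ^ p) * n ^ e      ∎))
    where
    open ≤-Reasoning
    regroup : ∀ b x y → b * b * (x * (y * y)) ≡ b * y * (b * y) * x
    regroup = solve-∀

  root⁻ : ∀ q p → n ^ (4 * q + 2 * p) ≤ m ^ q → S ^ q * n ^ p ≤ B ^ q
  root⁻ q p nᵉ≤mᵠ = square-cancel-≤ (*-cancelʳ-≤ _ _ (n ^ (4 * q)) {{m^n≢0 n (4 * q)}} (begin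
    S ^ q * n ^ p * (S ^ q * n ^ p) * n ^ (4 * q)    ≡⟨ regroup (S ^ q) (n ^ (4 * q)) (n ^ p) ⟩
    S ^ q * S ^ q * (n ^ (4 * q) * (n ^ p * n ^ p))
      ≡⟨ cong (λ z → S ^ q * S ^ q * (n ^ (4 * q) * z)) (trans (sym (^-distribˡ-+-* n p p)) (cong (λ z → n ^ (p + z)) (sym (+-identityʳ p)))) ⟩
    S ^ q * S ^ q * (n ^ (4 * q) * n ^ (2 * p))      ≡⟨ cong (S ^ q * S ^ q *_) (^-distribˡ-+-* n (4 * q) (2 * p)) ⟨
    S ^ q * S ^ q * n ^ (4 * q + 2 * p)              ≤⟨ raise q (4 * q + 2 * p) nᵉ≤mᵠ ⟩
    B ^ q * B ^ q * n ^ (4 * q)                      ∎))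
    where
    open ≤-Reasoning
    regroup : ∀ b x y → b * y * (b * y) * x ≡ b * b * (x * (y * y))
    regroup = solve-∀

  -- For time exponents from 2 on, the matching density exponent is not positive; m ≥ 1 alone
  -- already yields S ≤ B n².
  root-large : ∀ q p → .{{NonZero m}} → 4 * q ≤ 2 * p → S ^ q ≤ B ^ q * n ^ p
  root-large q p 4q≤2p = begin
    S ^ q                 ≤⟨ ^-monoˡ-≤ q S≤Bn² ⟩
    (B * (n ^ 2)) ^ q     ≡⟨ ^-distribʳ-* q B (n ^ 2) ⟩
    B ^ q * (n ^ 2) ^ q   ≡⟨ cong (B ^ q *_) (^-*-assoc n 2 q) ⟩
    B ^ q * n ^ (2 * q)   ≤⟨ *-monoʳ-≤ (B ^ q) (^-monoʳ-≤ n 2q≤p) ⟩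
    B ^ q * n ^ p         ∎
    where
    open ≤-Reasoning
    2q≤p : 2 * q ≤ p
    2q≤p = *-cancelˡ-≤ 2 (≤-trans (≤-reflexive (sym (*-assoc 2 2 q))) 4q≤2p)
    regroup : ∀ b n → b * b * (n * (n * (n * (n * 1)))) ≡ b * (n * (n * 1)) * (b * (n * (n * 1)))
    regroup = solve-∀
    S≤Bn² : S ≤ B * n ^ 2
    S≤Bn² = square-cancel-≤ (begin
      S * S                     ≤⟨ m≤n*m (S * S) m ⟩
      m * (S * S)               ≤⟨ mS²≤B²n⁴ ⟩
      B * B * n ^ 4             ≡⟨ regroup B n ⟩
      B * n ^ 2 * (B * n ^ 2)   ∎)

real-root : ∀ (δ : ℝ) n m S B .{{n≢0 : NonZero n}} .{{m≢0 : NonZero m}} →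
            n ^ℝ ((+ 3 / 2) +ℝ δ) ≤ m → m * (S * S) ≤ B * B * n ^ 4 →
            S ≤ B · n ^ℝ ((+ 5 / 4) -ℝ (½* δ))
real-root δ n m S B {{n≢0}} {{m≢0}} dense mS²≤B²n⁴ = bound
  where
  open Roots n m S B {{n≢0}} mS²≤B²n⁴

  density : ∀ P d e → + e ≡ + 4 ℤ.* + suc d ℤ.- + 2 ℤ.* P →
            ((+ 5 / 4) -ℝ (½* δ)) ℝ< mkℚᵘ P d → n ^ e ≤ m ^ suc d
  -- Both comparisons unfold to membership in the lower cut of δ, at -2 (r - 5/4) and at e / (d + 1)
  -- - 3/2; `exponent` identifies these two rationals up to `≃`.
  density P d e eq r> = dense (mkℚᵘ (+ e) d) (ℝ.respˡ δ (exponent P d e eq) r>)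

  bound : S ≤ B · n ^ℝ ((+ 5 / 4) -ℝ (½* δ))
  bound (mkℚᵘ (+ p) d) r> with 2 * p ≤? 4 * suc d
  ... | no 2p≰4q  = root-large (suc d) p {{m≢0}} (<⇒≤ (≰⇒> 2p≰4q))
  ... | yes 2p≤4q = root⁺ (suc d) p (4 * suc d ∸ 2 * p) (m∸n+n≡m 2p≤4q)
    (density (+ p) d (4 * suc d ∸ 2 * p) (begin
      + (4 * suc d ∸ 2 * p)                ≡⟨ ℤ.⊖-≥ 2p≤4q ⟨
      4 * suc d ℤ.⊖ 2 * p                  ≡⟨ ℤ.m-n≡m⊖n (4 * suc d) (2 * p) ⟨
      + (4 * suc d) ℤ.- + (2 * p)          ≡⟨ cong (λ z → + (4 * suc d) ℤ.- z) (ℤ.pos-* 2 p) ⟩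
      + 4 ℤ.* + suc d ℤ.- + 2 ℤ.* + p      ∎) r>)
    where open ≡-Reasoning
  bound (mkℚᵘ -[1+ p ] d) r> =
    root⁻ (suc d) (suc p) (density -[1+ p ] d (4 * suc d + 2 * suc p) refl r>)

theorem8 : (δ : ℝ) → 0ℚᵘ <ℝ δ → δ ℝ< ½ →
    Σ[ A ∈ Algorithm 4 ] Σ[ C ∈ ℕ ]
    (∀ (n : ℕ) .{{_ : NonZero n}} (G : Graph n) (I : AdjacencyLists G) →
    n ^ℝ ((+ 3 / 2) +ℝ δ) ≤ edges G →
    AlwaysCorrect A I (IsFourCycleOutput G) ×
    ExpectedTimeBound A I C ((+ 5 / 4) -ℝ (½* δ)))
theorem8 δ 0<δ δ<½ = search , 429 , λ n G I dense →
  let open Counting I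
      open Search I
      open Execution search I using (initial; steps; sumTapes)
      n³≤m² : n ^ 3 ≤ edges G * edges G
      -- Since δ > 0, the rational 3/2 lies below 3/2 + δ and may be used as a density exponent.
      n³≤m² = ≤-trans (dense (+ 3 / 2) (ℝ.respˡ δ (*≡* refl) 0<δ))
                      (≤-reflexive (cong (edges G *_) (*-identityʳ (edges G))))
  in search-correct , λ N →
     real-root δ n (edges G) (sumTapes N (steps initial)) (429 * n ^ N) {{m≢0 = n³≤M²⇒M≢0 {n} n³≤m²}} dense
       (combine {n} {edges G} {goodCount} {p = n ^ N} (4edges≤625goodCount² n³≤m²) (search-time N))
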